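{- Let $G=(V,E)$ be a fullerene graph with $n=|V|$ vertices, and let $\operatorname{perfmat} G$ be its number of perfect matchings. Then: (1) if $G$ has a hamiltonian cycle and $n$ is divisible by $4$, then $\operatorname{perfmat} G\le 8^{\frac n8}$; (2) if $G$ has a hamiltonian cycle and $n$ is not divisible by $4$, then $\operatorname{perfmat} G\le 8^{\frac{n-2}{8}}\sqrt3$; (3) in all cases, $\operatorname{perfmat} G\le 8^{\frac14\lfloor\frac{5n-4}{12}\rfloor}\,3^{\frac{n-2\lfloor\frac{5n-4}{12}\rfloor}{4}}$.
   Context: A fullerene graph is a planar cubic ($3$-regular) simple graph, embedded in the plane so that every face, including the unbounded one, is a pentagon or a hexagon (bounded by a cycle of length $5$ or $6$). -}

module Defs where

open import Data.Fin using (Fin; toℕ; _<?_; _≟_)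
open import Data.Fin.Properties using (all?)
open import Data.List using (List; []; _∷_; _++_; map; length; filter; allFin; cartesianProduct)
open import Data.Nat as ℕ using (ℕ; suc; _+_; _≤_)
open import Data.Nat.DivMod using (_mod_)
open import Data.Nat.GeneralisedArithmetic using (iterate)
open import Data.Product using (Σ; ∃; _×_; _,_; proj₁; proj₂)
open import Data.Sum using (_⊎_)
open import Function.Base using (_∘_)
open import Function.Bundles using (_⇔_)
open import Function.Definitions using (Injective)
open import Level using (0ℓ)
open import Relation.Binary.Construct.Closure.ReflexiveTransitive using (Star)
open import Relation.Binary.Core using (Rel)
open import Relation.Binary.Definitions using (Decidable; Symmetric)
open import Relation.Binary.PropositionalEquality using (_≡_)
open import Relation.Nullary using (¬_; Dec)
open import Relation.Nullary.Decidable using (_×-dec_; _⊎-dec_)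
import Relation.Unary as U

record SimpleGraph (n : ℕ) : Set₁ where
  infix 4 _~_ _~?_
  field
    _~_    : Rel (Fin n) 0ℓ
    _~?_   : Decidable _~_
    ~-sym  : Symmetric _~_
    ~-irr  : ∀ {v} → ¬ (v ~ v)

-- For a list without repetitions, these are its subsets, each listed once.
sublists : ∀ {A : Set} → List A → List (List A)
sublists []       = [] ∷ []
sublists (x ∷ xs) = sublists xs ++ map (x ∷_) (sublists xs)

-- Cyclic successor.
next : ∀ {ℓ} → Fin ℓ → Fin ℓ
next {suc k} i = suc (toℕ i) mod suc k

module _ {n : ℕ} (G : SimpleGraph n) where
  open SimpleGraph G

  degree : Fin n → ℕ
  degree v = length (filter (v ~?_) (allFin n))

  Cubic : Set
  Cubic = ∀ v → degree v ≡ 3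

  Connected : Set
  Connected = ∀ u v → Star _~_ u v

  -- The edge joining u and v is listed once, as the pair (u , v) with u < v.
  edges : List (Fin n × Fin n)
  edges = filter (λ (u , v) → (u <? v) ×-dec (u ~? v))
                 (cartesianProduct (allFin n) (allFin n))

  EndOf : Fin n → U.Pred (Fin n × Fin n) 0ℓ
  EndOf w (u , v) = w ≡ u ⊎ w ≡ v

  endOf? : ∀ w → U.Decidable (EndOf w)
  endOf? w (u , v) = (w ≟ u) ⊎-dec (w ≟ v)

  -- M is meant to be a sublist of edges.
  IsPerfectMatching : U.Pred (List (Fin n × Fin n)) 0ℓ
  IsPerfectMatching M = ∀ w → length (filter (endOf? w) M) ≡ 1

  isPerfectMatching? : U.Decidable IsPerfectMatching
  isPerfectMatching? M = all? (λ w → length (filter (endOf? w) M) ℕ.≟ 1)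

  perfmat : ℕ
  perfmat = length (filter isPerfectMatching? (sublists edges))

  record Cycle (ℓ : ℕ) : Set where
    field
      length≥3  : 3 ≤ ℓ
      vertex    : Fin ℓ → Fin n
      injective : Injective _≡_ _≡_ vertex
      adjacent  : ∀ i → vertex i ~ vertex (next i)

  Hamiltonian : Set
  Hamiltonian = ∃ λ ℓ → Σ (Cycle ℓ) λ C → ∀ v → ∃ λ i → Cycle.vertex C i ≡ v

  -- An edge with a direction.  Adjacency is irrelevant, so that darts are
  -- equal as soon as their end vertices are.
  record Dart : Set where
    constructor dart
    field
      source target : Fin n
      .joined       : source ~ target
  open Dart public

  reverseDart : Dart → Dart
  reverseDart (dart u v e) = dart v u (~-sym e)

  cycleDart : ∀ {ℓ} → Cycle ℓ → Fin ℓ → Dart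
  cycleDart C i = dart (vertex i) (vertex (next i)) (adjacent i)
    where open Cycle C

  -- An embedding of a connected graph with an edge in the plane (equivalently the sphere),
  -- given combinatorially by a rotation system of genus 0.  rotate sends a dart
  -- to the next one around its source; by the two laws on it, it is a cyclic
  -- permutation of the darts leaving each vertex.  The faces, including the
  -- unbounded one, are the orbits of faceStep, which traverses a dart and then
  -- turns to the next dart at the vertex reached.  For connected graphs,
  -- Euler's formula singles out the sphere among the closed orientable surfaces.
  record PlaneEmbedding : Set where
    field
      connected     : Connected
      rotate        : Dart → Dart
      rotate-source : ∀ d → source (rotate d) ≡ source d
      rotate-cyclic : ∀ d d′ → source d ≡ source d′ → ∃ λ k → iterate rotate d k ≡ d′

    faceStep : Dart → Dart
    faceStep = rotate ∘ reverseDart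

    field
      #faces    : ℕ
      face      : Dart → Fin #faces
      face-onto : ∀ f → ∃ λ d → face d ≡ f
      face-orbit : ∀ d d′ → face d ≡ face d′ ⇔ (∃ λ k → iterate faceStep d k ≡ d′)
      euler     : n + #faces ≡ length edges + 2

    -- The darts along f are exactly those of a cycle of length ℓ, traversed in
    -- one direction.
    BoundedByCycle : ℕ → Fin #faces → Set
    BoundedByCycle ℓ f = Σ (Cycle ℓ) λ C → ∀ d → face d ≡ f ⇔ (∃ λ i → cycleDart C i ≡ d)

  record Fullerene : Set where
    field
      cubic     : Cubic
      embedding : PlaneEmbedding
    open PlaneEmbedding embedding public
    field
      pentagonOrHexagon : ∀ f → BoundedByCycle 5 f ⊎ BoundedByCycle 6 f

{-# OPTIONS --safe #-}
-- Every fullerene graph, hamiltonian or not, satisfies perfmat G ^ 8 ≤ 8 ^ n, that is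
-- perfmat G ≤ 2 ^ (|E| / 4), and all three bounds follow from this one.
--
-- In a connected cubic graph, a nonempty set of vertices whose deletion leaves e edges
-- leaves at most 2 ^ (e / 4) perfect matchings: some remaining vertex has at most two
-- remaining neighbours, and branching on its partner deletes four edges in each of two
-- branches, up to exceptions in which the branches are unbalanced (3 and 6 edges) or forced.
--
-- For the whole graph, Euler's formula yields a pentagonal face.  Since all faces are
-- bounded by cycles of length 5 or 6, the third neighbours of its five vertices are distinct
-- and pairwise nonadjacent.  An odd number of the five vertices are matched to their third
-- neighbours: one in 5 ways, deleting 12 edges; three in 5 ways, deleting 16 edges; all five
-- in one way, deleting 20 edges.  Altogether 5/8 + 5/16 + 1/32 ≤ 1.
module Submission where

open import Defs
open import Data.Empty using (⊥; ⊥-elim)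
open import Data.Fin as Fin using (Fin; zero; suc; _≟_; _<?_; #_)
import Data.Fin.Properties as Finₚ
open import Data.List using (List; []; _∷_; _++_; length; filter; allFin; map; concat; cartesianProduct)
open import Data.List.Properties using (length-++; length-map; filter-++; filter-≐; length-tabulate; ∷-injectiveʳ)
open import Data.List.Membership.DecPropositional using () renaming (_∈?_ to member?)
open import Data.List.Membership.Propositional using (_∈_; _∉_)
open import Data.List.Membership.Propositional.Properties
open import Data.List.Relation.Unary.All as All using (All; []; _∷_)
open import Data.List.Relation.Unary.AllPairs using ([]; _∷_)
open import Data.List.Relation.Unary.Any using (Any; here; there)
open import Data.List.Relation.Unary.Unique.Propositional using (Unique)
open import Data.List.Relation.Unary.Unique.Propositional.Properties
  using (allFin⁺; filter⁺; cartesianProduct⁺; map⁺; ++⁺; Unique[x∷xs]⇒x∉xs)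
open import Data.Nat using (ℕ; suc; _+_; _*_; _∸_; _^_; _≤_; _<_; _≤?_; z≤n; s≤s)
open import Data.Nat.DivMod using (_/_; m/n*n≤m)
open import Data.Nat.Divisibility using (_∣_)
open import Data.Nat.GeneralisedArithmetic using (iterate)
open import Data.Nat.Induction using (<-wellFounded; Acc; acc)
import Data.Nat.Properties as ℕₚ
open import Data.Nat.Tactic.RingSolver using (solve-∀)
open import Data.Product using (Σ; ∃; _×_; _,_; proj₁; proj₂; swap)
open import Data.Sum as Sum using (_⊎_; inj₁; inj₂)
open import Data.Vec using (Vec; lookup; []; _∷_)
open import Data.Vec.Relation.Unary.All using ([]; _∷_) renaming (All to VecAll)
open import Data.Vec.Relation.Unary.All.Properties using () renaming (lookup⁺ to vecAll-lookup)
open import Data.Vec.Relation.Unary.AllPairs using ([]; _∷_)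
open import Data.Vec.Relation.Unary.Unique.Propositional using () renaming (Unique to VecUnique)
open import Data.Vec.Relation.Unary.Unique.Propositional.Properties using (lookup-injective)
open import Function.Base using (_∘_; case_of_)
open import Function.Bundles using (Equivalence)
open import Level using (0ℓ)
open import Relation.Binary.Construct.Closure.ReflexiveTransitive using (Star; ε; _◅_)
open import Relation.Binary.Definitions using (tri<; tri≈; tri>)
open import Relation.Binary.PropositionalEquality using (_≡_; _≢_; refl; sym; trans; cong; cong₂; subst; ≢-sym)
open import Relation.Nullary using (¬_; Dec; yes; no; contradiction)
open import Relation.Nullary.Decidable using (False; toWitnessFalse; decidable-stable; from-yes; recompute; ¬?; _×-dec_)
open import Relation.Unary using (Decidable; Pred)

-- The bound 2 ^ (|E| / 4) fails for connected cubic graphs in general: K4 has 6 edges and 3 perfect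
-- matchings, and 3 ^ 8 exceeds 2 ^ 12. Branching alone therefore cannot start on the intact graph:
-- a vertex has three possible partners, an adjacent pair takes five edges with it, and 3 · 2 ^
-- (-5/4) > 1. A deleted vertex is what brings a remaining one down to two partners. The pentagon
-- serves as the first step because its outward neighbours are independent: no deleted edge is
-- counted twice, and the patterns then delete enough edges to pay for their number.

-- Faces near a pentagon

-- Turn x v y: the face walk that runs along the dart from x to v continues to y.
module FaceWalks {V : Set} (_~_ : V → V → Set) (Turn : V → V → V → Set) where

  -- The walk x y z w t shows five vertices of a face of length five or six, so it returns to x at
  -- once or through one further vertex. The closing turns are recorded in order to be compared with
  -- turns already known.
  data Closing (x y z w t : V) : Set where
    five : Turn w t x → Turn t x y → Closing x y z w t
    six  : ∀ {r} → r ≢ x → Turn w t r → Turn t r x → Turn r x y → Closing x y z w t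

  -- `Turn x v y` has a second reading: y follows x in the rotation at v. The fields `cyclic` and
  -- `neighbours` say that this rotation is a 3-cycle; `no-triangle`, `no-square` and `closing`
  -- express that faces are cycles of length 5 or 6.
  record CubicFaceWalks : Set where
    field
      ~-sym      : ∀ {x y} → x ~ y → y ~ x
      ~-irr      : ∀ {x} → ¬ (x ~ x)
      turn-source : ∀ {x v y} → Turn x v y → x ~ v
      turn-target : ∀ {x v y} → Turn x v y → v ~ y
      turn-≢     : ∀ {x v y} → Turn x v y → x ≢ y
      turn-next  : ∀ {x v} → x ~ v → ∃ λ y → Turn x v y
      functional : ∀ {x v y y′} → Turn x v y → Turn x v y′ → y ≡ y′
      injective  : ∀ {x x′ v y} → Turn x v y → Turn x′ v y → x ≡ x′
      cyclic     : ∀ {x v y z} → Turn x v y → Turn y v z → Turn z v x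
      neighbours : ∀ {x v y z w} → Turn x v y → Turn y v z → w ~ v → w ≡ x ⊎ w ≡ y ⊎ w ≡ z
      no-triangle : ∀ {x y z} → Turn x y z → ¬ Turn y z x
      no-square  : ∀ {x y z w} → Turn x y z → Turn y z w → ¬ Turn z w x
      closing    : ∀ {x y z w t} → Turn x y z → Turn y z w → Turn z w t → Closing x y z w t

  module _ (walks : CubicFaceWalks) where
    open CubicFaceWalks walks

    turn-antisym : ∀ {x v y} → Turn x v y → ¬ Turn y v x
    turn-antisym p q = turn-≢ (cyclic p q) refl

    -- Among three neighbours in cyclic order, any two are consecutive in one direction or the
    -- other.
    either-side : ∀ {x v y} → x ~ v → y ~ v → x ≢ y → Turn x v y ⊎ Turn y v x
    either-side x~v y~v x≢y with turn-next x~v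
    ... | z , xvz with turn-next (~-sym (turn-target xvz))
    ... | w , zvw with neighbours xvz zvw y~v
    ... | inj₁ refl        = contradiction refl x≢y
    ... | inj₂ (inj₁ refl) = inj₁ xvz
    ... | inj₂ (inj₂ refl) = inj₂ (cyclic xvz zvw)

    -- A pentagonal face with the third neighbour of each of its vertices, the
    -- primed ones.
    record Pentagon (a b c d e a′ b′ c′ d′ e′ : V) : Set where
      field
        abc : Turn a b c
        bcd : Turn b c d
        cde : Turn c d e
        dea : Turn d e a
        eab : Turn e a b
        baa′ : Turn b a a′
        cbb′ : Turn c b b′
        dcc′ : Turn d c c′
        edd′ : Turn e d d′
        aee′ : Turn a e e′
        a′ae : Turn a′ a e
        b′ba : Turn b′ b a
        c′cb : Turn c′ c b
        d′dc : Turn d′ d c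
        e′ed : Turn e′ e d

    rotatePentagon : ∀ {a b c d e a′ b′ c′ d′ e′} →
      Pentagon a b c d e a′ b′ c′ d′ e′ → Pentagon b c d e a b′ c′ d′ e′ a′
    rotatePentagon P = record
      { abc = bcd ; bcd = cde ; cde = dea ; dea = eab ; eab = abc
      ; baa′ = cbb′ ; cbb′ = dcc′ ; dcc′ = edd′ ; edd′ = aee′ ; aee′ = baa′
      ; a′ae = b′ba ; b′ba = c′cb ; c′cb = d′dc ; d′dc = e′ed ; e′ed = a′ae }
      where open Pentagon P

    withThirdNeighbours : ∀ {a b c d e} →
      Turn a b c → Turn b c d → Turn c d e → Turn d e a → Turn e a b →
      ∃ λ a′ → ∃ λ b′ → ∃ λ c′ → ∃ λ d′ → ∃ λ e′ → Pentagon a b c d e a′ b′ c′ d′ e′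
    withThirdNeighbours abc bcd cde dea eab =
      _ , _ , _ , _ , _ , record
      { abc = abc ; bcd = bcd ; cde = cde ; dea = dea ; eab = eab
      ; baa′ = third eab ; cbb′ = third abc ; dcc′ = third bcd ; edd′ = third cde ; aee′ = third dea
      ; a′ae = cyclic eab (third eab) ; b′ba = cyclic abc (third abc) ; c′cb = cyclic bcd (third bcd)
      ; d′dc = cyclic cde (third cde) ; e′ed = cyclic dea (third dea) }
      where
      third : ∀ {x v y} (p : Turn x v y) → Turn y v (proj₁ (turn-next (~-sym (turn-target p))))
      third p = proj₂ (turn-next (~-sym (turn-target p)))

    module _ {a b c d e a′ b′ c′ d′ e′} (P : Pentagon a b c d e a′ b′ c′ d′ e′) where
      open Pentagon P

      a~b : a ~ b
      a~b = turn-source abc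

      a~a′ : a ~ a′
      a~a′ = turn-target baa′

      a≢b : a ≢ b
      a≢b refl = ~-irr a~b

      a≢c : a ≢ c
      a≢c = turn-≢ abc

      aroundVertex : ∀ {w} → w ~ a → w ≡ b ⊎ w ≡ e ⊎ w ≡ a′
      aroundVertex w~a with neighbours eab baa′ w~a
      ... | inj₁ p        = inj₂ (inj₁ p)
      ... | inj₂ (inj₁ p) = inj₁ p
      ... | inj₂ (inj₂ p) = inj₂ (inj₂ p)

      third≢a : a′ ≢ a
      third≢a refl = ~-irr a~a′

      third≢b : a′ ≢ b
      third≢b refl = turn-≢ baa′ refl

      third≢e : a′ ≢ e
      third≢e refl = turn-≢ a′ae refl

      -- A chord ac would make the face walk beyond it return to b.
      third≢c : a′ ≢ c
      third≢c refl with neighbours bcd dcc′ a~a′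
      ... | inj₁ refl        = ~-irr a~b
      ... | inj₂ (inj₁ refl) = turn-≢ dea refl
      ... | inj₂ (inj₂ refl) = no-triangle baa′ c′cb

      third≢d : a′ ≢ d
      third≢d refl with neighbours cde edd′ a~a′
      ... | inj₁ refl        = turn-≢ abc refl
      ... | inj₂ (inj₁ refl) = ~-irr (turn-source eab)
      ... | inj₂ (inj₂ refl) = no-triangle edd′ a′ae

      thirds-distinct₁ : a′ ≢ b′
      thirds-distinct₁ refl = no-triangle b′ba baa′

    module _ {a b c d e a′ b′ c′ d′ e′} (P : Pentagon a b c d e a′ b′ c′ d′ e′) where
      open Pentagon P

      private
        Pᵇ = rotatePentagon P
        Pᶜ = rotatePentagon Pᵇ
        Pᵈ = rotatePentagon Pᶜ
        Pᵉ = rotatePentagon Pᵈ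

      -- The walk along d c a′ a e would have to close up through e′ and through d′.
      thirds-distinct₂ : a′ ≢ c′
      thirds-distinct₂ refl with either-side (a~a′ P) (a~a′ Pᶜ) (a≢c P)
      ... | inj₁ aa′c = no-square baa′ aa′c c′cb
      ... | inj₂ ca′a with closing dcc′ ca′a a′ae
      ... | five aed _      = third≢e Pᵉ (functional aee′ aed)
      ... | six _ aer _ rdc =
        thirds-distinct₁ Pᵈ (trans (injective d′dc rdc) (functional aer aee′))

      -- The four-cycle a b b′ a′ would be a face unless both a′ and b′ turn the other way. In that
      -- case c b b′ a′ a is a face walk, and closing it up forces e or e′ to be c.
      thirds-nonadjacent₁ : ¬ (a′ ~ b′)
      thirds-nonadjacent₁ a′~b′
        with either-side (a~a′ P) (~-sym a′~b′) (λ p → third≢e Pᵇ (sym p))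
           | either-side (a~a′ Pᵇ) a′~b′ (λ p → third≢b P (sym p))
      ... | inj₁ aa′b′ | _ = no-square b′ba baa′ aa′b′
      ... | inj₂ b′a′a | inj₂ a′b′b = no-square a′b′b b′ba baa′
      ... | inj₂ b′a′a | inj₁ bb′a′ with closing cbb′ bb′a′ b′a′a
      ... | five a′ac _ = turn-≢ cde (functional a′ac a′ae)
      ... | six _ a′ar arc _ with functional a′ar a′ae
      ... | refl = third≢d Pᵉ (functional aee′ arc)

      -- The cases are the possible turns of the five-cycle a b c c′ a′ at a′ and at c′.  In the
      -- two long ones, overlapping walks force a face of length three at a further vertex x.
      thirds-nonadjacent₂ : ¬ (a′ ~ c′)
      thirds-nonadjacent₂ a′~c′
        with either-side (a~a′ P) (~-sym a′~c′) (λ p → third≢d Pᶜ (sym p))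
           | either-side (a~a′ Pᶜ) a′~c′ (λ p → third≢c P (sym p))
      ... | inj₁ aa′c′ | inj₂ a′c′c with closing baa′ aa′c′ a′c′c
      ...   | five _ cba        = third≢e Pᵇ (functional cbb′ cba)
      ...   | six r≢b c′cr _ _  = r≢b (functional c′cr c′cb)
      thirds-nonadjacent₂ a′~c′ | inj₁ aa′c′ | inj₁ cc′a′
        with turn-next (~-sym (turn-target cc′a′))
      ...   | x , a′c′x with cyclic cc′a′ a′c′x | closing b′ba baa′ aa′c′
      ...   | xc′c | five a′c′b′ _ with functional a′c′x a′c′b′
      ...     | refl = no-square xc′c c′cb cbb′
      thirds-nonadjacent₂ a′~c′ | inj₁ aa′c′ | inj₁ cc′a′
              | x , a′c′x | xc′c | six _ a′c′r xb′ b′b with functional a′c′x a′c′r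
      ...     | refl with closing xc′c c′cb cbb′
      ...       | five bb′x _ = turn-antisym bb′x b′b
      ...       | six _ bb′y _ yxc′ = no-triangle (cyclic b′b bb′y) (cyclic yxc′ xb′)
      thirds-nonadjacent₂ a′~c′ | inj₂ c′a′a | inj₁ cc′a′ with closing dcc′ cc′a′ c′a′a
      ...   | five a′ad _ with functional a′ad a′ae
      ...     | refl = ~-irr (turn-source dea)
      thirds-nonadjacent₂ a′~c′ | inj₂ c′a′a | inj₁ cc′a′
            | six _ a′ar ard _ with functional a′ar a′ae
      ...     | refl = third≢e Pᵉ (functional aee′ ard)
      thirds-nonadjacent₂ a′~c′ | inj₂ c′a′a | inj₂ a′c′c
        with turn-next (~-sym (turn-target c′a′a))
      ...   | x , aa′x with closing (cyclic c′a′a aa′x) a′c′c c′cb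
      ...   | five cbx _ with functional cbb′ cbx
      ...     | refl = no-square b′ba baa′ aa′x
      thirds-nonadjacent₂ a′~c′ | inj₂ c′a′a | inj₂ a′c′c
            | x , aa′x | six _ cbr bb′x b′xa′ with functional cbb′ cbr
      ...     | refl with closing b′ba baa′ aa′x
      ...       | five a′xb′ _ = turn-antisym a′xb′ b′xa′
      ...       | six _ a′xy _ yb′b = no-triangle (cyclic b′xa′ a′xy) (cyclic yb′b bb′x)

-- Counting with repetition-free lists

module _ {A : Set} where

  unique⊆⇒length≤ : {xs ys : List A} → Unique xs → (∀ {x} → x ∈ xs → x ∈ ys) → length xs ≤ length ys
  unique⊆⇒length≤ {[]} _ _ = z≤n
  unique⊆⇒length≤ {x ∷ xs} (x∉xs ∷ uniq) xs⊆ys with ∈-∃++ (xs⊆ys (here refl))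
  ... | as , bs , refl = ℕₚ.≤-trans (s≤s (unique⊆⇒length≤ uniq xs⊆rest))
                           (ℕₚ.≤-reflexive lengths)
    where
    xs⊆rest : ∀ {y} → y ∈ xs → y ∈ as ++ bs
    xs⊆rest y∈xs with ∈-++⁻ as (xs⊆ys (there y∈xs))
    ... | inj₁ y∈as         = ∈-++⁺ˡ y∈as
    ... | inj₂ (here refl)  = contradiction refl (All.lookup x∉xs y∈xs)
    ... | inj₂ (there y∈bs) = ∈-++⁺ʳ as y∈bs

    lengths : suc (length (as ++ bs)) ≡ length (as ++ x ∷ bs)
    lengths rewrite length-++ as {bs} | length-++ as {x ∷ bs} = sym (ℕₚ.+-suc (length as) (length bs))

module _ {n : ℕ} (G : SimpleGraph n) (cubic : Cubic G) where
  open SimpleGraph G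

  degree-bound : ∀ {v xs} → Unique xs → (∀ {w} → w ∈ xs → v ~ w) → length xs ≤ 3
  degree-bound {v} uniq adj = subst (_ ≤_) (cubic v)
    (unique⊆⇒length≤ uniq λ w∈xs → ∈-filter⁺ (v ~?_) (∈-allFin _) (adj w∈xs))

  degree-cover : ∀ {v xs} → (∀ {w} → v ~ w → w ∈ xs) → 3 ≤ length xs
  degree-cover {v} cover = subst (_≤ _) (cubic v)
    (unique⊆⇒length≤ (filter⁺ (v ~?_) (allFin⁺ n))
      λ w∈ → cover (proj₂ (∈-filter⁻ (v ~?_) {xs = allFin n} w∈)))

-- Rotations and face walks of a fullerene graph

module _ {n : ℕ} (G : SimpleGraph n) (F : Fullerene G) where
  open SimpleGraph G
  open Fullerene F

  Turn : Fin n → Fin n → Fin n → Set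
  Turn x v y = Σ (x ~ v) λ e → Σ (v ~ y) λ e′ → faceStep (dart x v e) ≡ dart v y e′

  open FaceWalks _~_ Turn

  -- The field `joined` is irrelevant; decidability of adjacency turns it back into usable evidence.
  joined-recompute : (d : Dart G) → source d ~ target d
  joined-recompute (dart u v e) = recompute (u ~? v) e

  dart-≡ : {d d′ : Dart G} → source d ≡ source d′ → target d ≡ target d′ → d ≡ d′
  dart-≡ {dart _ _ _} {dart _ _ _} refl refl = refl

  -- Rotation is transitive on the darts leaving a vertex, so an invariant property spreads from one
  -- of them to all.
  rotate-closed : (P : Dart G → Set) → (∀ {d} → P d → P (rotate d)) →
    ∀ {d d′} → P d → source d ≡ source d′ → P d′
  rotate-closed P closed {d} {d′} Pd eq with rotate-cyclic d d′ eq
  ... | k , refl = go k Pd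
    where
    go : ∀ k {d} → P d → P (iterate rotate d k)
    go 0       Pd = Pd
    go (suc k) Pd = go k (closed Pd)

  neighbours-among : ∀ (d : Dart G) (ds : List (Dart G)) → (∀ {d′} → source d ≡ source d′ → d′ ∈ ds) →
    3 ≤ length ds
  neighbours-among d ds cover = ℕₚ.≤-trans
    (degree-cover G cubic {source d} {map target ds} λ {w} v~w → ∈-map⁺ target (cover {dart (source d) w v~w} refl))
    (ℕₚ.≤-reflexive (length-map target ds))
    where
    open import Data.List using (map)
    open import Data.List.Properties using (length-map)

  -- Otherwise the two darts would be closed under `rotate`, hence would be all the darts at a
  -- vertex of degree three.
  rotate-distinct : ∀ d → rotate (rotate d) ∉ d ∷ rotate d ∷ []
  rotate-distinct d d₂∈ with neighbours-among d (d ∷ rotate d ∷ [])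
      (rotate-closed (_∈ d ∷ rotate d ∷ []) closed (here refl))
    where
    closed : ∀ {d′} → d′ ∈ d ∷ rotate d ∷ [] → rotate d′ ∈ d ∷ rotate d ∷ []
    closed (here refl)         = there (here refl)
    closed (there (here refl)) = d₂∈
  ... | s≤s (s≤s ())

  rotate-≢ : ∀ d → rotate d ≢ d
  rotate-≢ d eq = rotate-distinct d (here (trans (cong rotate eq) eq))

  -- If the third rotation led to a new target, `d` and its three rotations would end at four
  -- distinct neighbours of one vertex.
  rotate³ : ∀ d → rotate (rotate (rotate d)) ≡ d
  rotate³ d with target (rotate (rotate (rotate d))) ≟ target d
  ... | yes eq = dart-≡ (trans (rotate-source _) (trans (rotate-source _) (rotate-source d))) eq
  ... | no ≢d = contradiction (degree-bound G cubic {source d} {map target ds} uniq adj) λ { (s≤s (s≤s (s≤s ()))) }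
    where
    open import Data.List using (map)
    d₁ = rotate d
    d₂ = rotate d₁
    d₃ = rotate d₂
    ds = d ∷ d₁ ∷ d₂ ∷ d₃ ∷ []
    s₁ : source d₁ ≡ source d
    s₁ = rotate-source d
    s₂ : source d₂ ≡ source d
    s₂ = trans (rotate-source d₁) s₁
    s₃ : source d₃ ≡ source d
    s₃ = trans (rotate-source d₂) s₂

    differ : ∀ {d d′ v} → source d ≡ v → source d′ ≡ v → d′ ≢ d → target d ≢ target d′
    differ p q d≢d′ eq = d≢d′ (dart-≡ (trans q (sym p)) (sym eq))

    uniq : Unique (map target ds)
    uniq = (differ refl s₁ (rotate-≢ d) ∷ differ refl s₂ (λ eq → rotate-distinct d (here eq)) ∷ (λ eq → ≢d (sym eq)) ∷ [])
         ∷ (differ s₁ s₂ (rotate-≢ d₁) ∷ differ s₁ s₃ (λ eq → rotate-distinct d₁ (here eq)) ∷ [])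
         ∷ (differ s₂ s₃ (rotate-≢ d₂) ∷ []) ∷ [] ∷ []

    adj : ∀ {w} → w ∈ map target ds → source d ~ w
    adj (here refl) = joined-recompute d
    adj (there (here refl)) = subst (_~ target d₁) s₁ (joined-recompute d₁)
    adj (there (there (here refl))) = subst (_~ target d₂) s₂ (joined-recompute d₂)
    adj (there (there (there (here refl)))) = subst (_~ target d₃) s₃ (joined-recompute d₃)

  around : ∀ {d d′} → source d ≡ source d′ → d′ ∈ d ∷ rotate d ∷ rotate (rotate d) ∷ []
  around {d} = rotate-closed (_∈ d ∷ rotate d ∷ rotate (rotate d) ∷ []) closed (here refl)
    where
    closed : ∀ {d′} → d′ ∈ d ∷ rotate d ∷ rotate (rotate d) ∷ [] → rotate d′ ∈ d ∷ rotate d ∷ rotate (rotate d) ∷ []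
    closed (here refl)                 = there (here refl)
    closed (there (here refl))         = there (there (here refl))
    closed (there (there (here refl))) = here (rotate³ d)

  Boundary : ℕ → Fin n → Fin n → Set
  Boundary ℓ x y = Σ (Cycle G ℓ) λ C → let open Cycle C in
    (∃ λ i → vertex i ≡ x × vertex (next i) ≡ y)
    × (∀ j → Turn (vertex j) (vertex (next j)) (vertex (next (next j))))

  -- A face step stays in its face, so it leads from one dart of the bounding cycle to another; the
  -- source of the new dart and injectivity of `vertex` identify it as the next one.
  faceBoundary : ∀ {ℓ f} → BoundedByCycle ℓ f → ∀ {x y} (e : x ~ y) → face (dart x y e) ≡ f → Boundary ℓ x y
  faceBoundary {ℓ} {f} (C , along) {x} {y} e eq with Equivalence.to (along (dart x y e)) eq
  ... | i , cyc = C , (i , cong source cyc , cong target cyc) , turns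
    where
    open Cycle C
    turns : ∀ j → Turn (vertex j) (vertex (next j)) (vertex (next (next j)))
    turns j with Equivalence.to (along (faceStep (cycleDart G C j)))
          (trans (sym (Equivalence.from (face-orbit (cycleDart G C j) _) (1 , refl)))
                 (Equivalence.from (along (cycleDart G C j)) (j , refl)))
    ... | k , step with injective (trans (cong source step) (rotate-source (reverseDart G (cycleDart G C j))))
    ...   | refl = adjacent j , adjacent (next j) , sym step

  boundary : ∀ {x y} → x ~ y → Boundary 5 x y ⊎ Boundary 6 x y
  boundary {x} {y} e with pentagonOrHexagon (face (dart x y e))
  ... | inj₁ B = inj₁ (faceBoundary B e refl)
  ... | inj₂ B = inj₂ (faceBoundary B e refl)

  turn-functional : ∀ {x v y y′} → Turn x v y → Turn x v y′ → y ≡ y′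
  turn-functional (_ , _ , p) (_ , _ , q) = cong target (trans (sym p) q)

  private
    next-no-short-period : ∀ {ℓ} → ℓ ≡ 5 ⊎ ℓ ≡ 6 → ∀ (i : Fin ℓ) →
      next (next (next i)) ≢ i × next (next (next (next i))) ≢ i
    next-no-short-period (inj₁ refl) i =
        from-yes (Finₚ.all? λ (i : Fin 5) → ¬? (next (next (next i)) ≟ i)) i
      , from-yes (Finₚ.all? λ (i : Fin 5) → ¬? (next (next (next (next i))) ≟ i)) i
    next-no-short-period (inj₂ refl) i =
        from-yes (Finₚ.all? λ (i : Fin 6) → ¬? (next (next (next i)) ≟ i)) i
      , from-yes (Finₚ.all? λ (i : Fin 6) → ¬? (next (next (next (next i))) ≟ i)) i

    next⁵ : ∀ (i : Fin 5) → next (next (next (next (next i)))) ≡ i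
    next⁵ = from-yes (Finₚ.all? λ (i : Fin 5) → next (next (next (next (next i)))) ≟ i)

    next⁶ : ∀ (i : Fin 6) →
      next (next (next (next (next (next i))))) ≡ i × next (next (next (next (next i)))) ≢ i
    next⁶ = from-yes (Finₚ.all? λ (i : Fin 6) →
      (next (next (next (next (next (next i))))) ≟ i) ×-dec ¬? (next (next (next (next (next i)))) ≟ i))

  someBoundary : ∀ {x y} → x ~ y → ∃ λ ℓ → (ℓ ≡ 5 ⊎ ℓ ≡ 6) × Boundary ℓ x y
  someBoundary e with boundary e
  ... | inj₁ B = 5 , inj₁ refl , B
  ... | inj₂ B = 6 , inj₂ refl , B

  turn-source : ∀ {x v y} → Turn x v y → x ~ v
  turn-source (e , _ , _) = e

  no-triangle : ∀ {x y z} → Turn x y z → ¬ Turn y z x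
  no-triangle p q with someBoundary (turn-source p)
  ... | ℓ , ℓ≡ , C , (i , refl , refl) , turns with turn-functional p (turns i)
  ...   | refl = proj₁ (next-no-short-period ℓ≡ i) (Cycle.injective C (sym (turn-functional q (turns (next i)))))

  no-square : ∀ {x y z w} → Turn x y z → Turn y z w → ¬ Turn z w x
  no-square p q r with someBoundary (turn-source p)
  ... | ℓ , ℓ≡ , C , (i , refl , refl) , turns with turn-functional p (turns i)
  ...   | refl with turn-functional q (turns (next i))
  ...     | refl = proj₂ (next-no-short-period ℓ≡ i) (Cycle.injective C (sym (turn-functional r (turns (next (next i))))))

  closing : ∀ {x y z w t} → Turn x y z → Turn y z w → Turn z w t → Closing x y z w t
  closing p q r with boundary (turn-source p)
  closing p q r | inj₁ (C , (i , refl , refl) , turns) with turn-functional p (turns i)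
  ... | refl with turn-functional q (turns (next i))
  ...   | refl with turn-functional r (turns (next (next i)))
  ...     | refl = five
    (subst (λ j → Turn (v i₃) (v i₄) (v j)) (next⁵ i) (turns i₃))
    (subst (λ j → Turn (v i₄) (v j) (v (next j))) (next⁵ i) (turns i₄))
    where
    v = Cycle.vertex C
    i₃ = next (next (next i))
    i₄ = next i₃
  closing p q r | inj₂ (C , (i , refl , refl) , turns) with turn-functional p (turns i)
  ... | refl with turn-functional q (turns (next i))
  ...   | refl with turn-functional r (turns (next (next i)))
  ...     | refl = six
    (λ eq → proj₂ (next⁶ i) (Cycle.injective C eq))
    (turns i₃)
    (subst (λ j → Turn (v i₄) (v i₅) (v j)) (proj₁ (next⁶ i)) (turns i₄))
    (subst (λ j → Turn (v i₅) (v j) (v (next j))) (proj₁ (next⁶ i)) (turns i₅))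
    where
    v = Cycle.vertex C
    i₃ = next (next (next i))
    i₄ = next i₃
    i₅ = next i₄

  cubicFaceWalks : CubicFaceWalks
  cubicFaceWalks = record
    { ~-sym = ~-sym
    ; ~-irr = ~-irr
    ; turn-source = turn-source
    ; turn-target = λ (_ , e , _) → e
    ; turn-≢ = λ { (e , e′ , eq) refl → rotate-≢ _ eq }
    ; turn-next = turn-next
    ; functional = turn-functional
    -- Two further rotations undo the rotation in a turn, by `rotate³`.
    ; injective = λ { (e , e′ , p) (e″ , e‴ , q) → cong target
        (trans (sym (rotate³ _)) (trans (cong (λ d → rotate (rotate d)) (trans p (sym q))) (rotate³ _))) }
    ; cyclic = λ { (e , e′ , p) (e″ , e‴ , q) → ~-sym e‴ , ~-sym e ,
        trans (sym (cong rotate (trans (cong rotate p) q))) (rotate³ _) }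
    ; neighbours = λ { (e , e′ , p) (e″ , e‴ , q) w~v →
        among p q (around {dart _ _ (~-sym e)} {dart _ _ (~-sym w~v)} refl) }
    ; no-triangle = no-triangle
    ; no-square = no-square
    ; closing = closing
    }
    where
    among : ∀ {v x y z w} .{e₀ : v ~ x} .{e₁ : v ~ y} .{e₂ : v ~ z} .{e₃ : v ~ w} →
      rotate (dart v x e₀) ≡ dart v y e₁ → rotate (dart v y e₁) ≡ dart v z e₂ →
      dart v w e₃ ∈ dart v x e₀ ∷ rotate (dart v x e₀) ∷ rotate (rotate (dart v x e₀)) ∷ [] →
      w ≡ x ⊎ w ≡ y ⊎ w ≡ z
    among p q (here eq) = inj₁ (cong target eq)
    among p q (there (here eq)) = inj₂ (inj₁ (cong target (trans eq p)))
    among p q (there (there (here eq))) = inj₂ (inj₂ (cong target (trans eq (trans (cong rotate p) q))))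

    turn-next : ∀ {x v} → x ~ v → ∃ λ y → Turn x v y
    turn-next {x} {v} e = target d , e , subst (_~ target d) (rotate-source _) (joined-recompute d)
      , dart-≡ (rotate-source _) refl
      where d = faceStep (dart x v e)

module _ {A B : Set} {P : Pred (A × B) 0ℓ} (P? : Decidable P) where

  length-filter-map : ∀ x (ys : List B) →
    length (filter P? (map (x ,_) ys)) ≡ length (filter (λ y → P? (x , y)) ys)
  length-filter-map x []       = refl
  length-filter-map x (y ∷ ys) with P? (x , y)
  ... | yes _ = cong suc (length-filter-map x ys)
  ... | no _  = length-filter-map x ys

  length-filter-cartesianProduct : ∀ {k} (xs : List A) {ys : List B} →
    (∀ x → length (filter (λ y → P? (x , y)) ys) ≡ k) →
    length (filter P? (cartesianProduct xs ys)) ≡ length xs * k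
  length-filter-cartesianProduct []       row = refl
  length-filter-cartesianProduct (x ∷ xs) {ys} row = trans
    (trans (cong length (filter-++ P? (map (x ,_) ys) (cartesianProduct xs ys)))
           (length-++ (filter P? (map (x ,_) ys))))
    (cong₂ _+_ (trans (length-filter-map x ys) (row x)) (length-filter-cartesianProduct xs row))

length-cartesianProduct : {A B : Set} (xs : List A) (ys : List B) →
  length (cartesianProduct xs ys) ≡ length xs * length ys
length-cartesianProduct []       ys = refl
length-cartesianProduct (x ∷ xs) ys = trans (length-++ (map (x ,_) ys))
  (cong₂ _+_ (length-map (x ,_) ys) (length-cartesianProduct xs ys))

-- Counting edges

module Residual {n : ℕ} (G : SimpleGraph n) where
  open SimpleGraph G

  -- R is a set of deleted vertices; an arc is an edge with a direction.
  Arc : List (Fin n) → Pred (Fin n × Fin n) 0ℓ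
  Arc R (u , v) = u ~ v × u ∉ R × v ∉ R

  arc? : ∀ R → Decidable (Arc R)
  arc? R (u , v) = (u ~? v) ×-dec (¬? (member? _≟_ u R) ×-dec ¬? (member? _≟_ v R))

  arcs : List (Fin n) → List (Fin n × Fin n)
  arcs R = filter (arc? R) (cartesianProduct (allFin n) (allFin n))

  #arcs : List (Fin n) → ℕ
  #arcs R = length (arcs R)

  arcs-unique : ∀ R → Unique (arcs R)
  arcs-unique R = filter⁺ (arc? R) (cartesianProduct⁺ (allFin⁺ n) (allFin⁺ n))

  ∈-arcs⁺ : ∀ {R u v} → Arc R (u , v) → (u , v) ∈ arcs R
  ∈-arcs⁺ {R} = ∈-filter⁺ (arc? R) (∈-cartesianProduct⁺ (∈-allFin _) (∈-allFin _))

  ∈-arcs⁻ : ∀ {R u v} → (u , v) ∈ arcs R → Arc R (u , v)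
  ∈-arcs⁻ {R} p = proj₂ (∈-filter⁻ (arc? R) {xs = cartesianProduct (allFin n) (allFin n)} p)

  #arcs-cubic : Cubic G → #arcs [] ≡ n * 3
  #arcs-cubic cubic = trans
    (length-filter-cartesianProduct (arc? []) (allFin n) row)
    (cong (_* 3) (length-tabulate (λ (i : Fin n) → i)))
    where
    row : ∀ u → length (filter (λ v → arc? [] (u , v)) (allFin n)) ≡ 3
    row u = trans (cong length (filter-≐ (λ v → arc? [] (u , v)) (u ~?_)
      (proj₁ , λ e → e , (λ ()) , λ ()) (allFin n))) (cubic u)

  edge? : Decidable (λ ((u , v) : Fin n × Fin n) → (u Fin.< v) × u ~ v)
  edge? (u , v) = (u <? v) ×-dec (u ~? v)

  ∈-edges⁺ : ∀ {u v} → u Fin.< v → u ~ v → (u , v) ∈ edges G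
  ∈-edges⁺ u<v u~v = ∈-filter⁺ edge? (∈-cartesianProduct⁺ (∈-allFin _) (∈-allFin _)) (u<v , u~v)

  ∈-edges⁻ : ∀ {u v} → (u , v) ∈ edges G → (u Fin.< v) × u ~ v
  ∈-edges⁻ p = proj₂ (∈-filter⁻ edge? {xs = cartesianProduct (allFin n) (allFin n)} p)

  edges-unique : Unique (edges G)
  edges-unique = filter⁺ edge? (cartesianProduct⁺ (allFin⁺ n) (allFin⁺ n))

  #arcs≤2#edges : #arcs [] ≤ length (edges G) + length (edges G)
  #arcs≤2#edges = ℕₚ.≤-trans (unique⊆⇒length≤ (arcs-unique []) either)
    (ℕₚ.≤-reflexive (trans (length-++ (edges G)) (cong (length (edges G) +_) (length-map swap (edges G)))))
    where
    either : ∀ {a} → a ∈ arcs [] → a ∈ edges G ++ map swap (edges G)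
    either {u , v} a∈ with ∈-arcs⁻ {[]} a∈ | Finₚ.<-cmp u v
    ... | u~v , _ | tri< u<v _ _ = ∈-++⁺ˡ (∈-edges⁺ u<v u~v)
    ... | u~v , _ | tri≈ _ refl _ = ⊥-elim (~-irr u~v)
    ... | u~v , _ | tri> _ _ v<u = ∈-++⁺ʳ (edges G) (∈-map⁺ swap (∈-edges⁺ v<u (~-sym u~v)))

-- Existence of a pentagonal face

module _ {n : ℕ} (G : SimpleGraph n) (F : Fullerene G) where
  open SimpleGraph G
  open Fullerene F
  open Residual G

  -- Each dart lies in a single face and occurs once on its boundary cycle, so the six sides of all
  -- the faces are pairwise distinct arcs.
  hexagons-bound : (∀ f → BoundedByCycle 6 f) → #faces * 6 ≤ #arcs []
  hexagons-bound hexagon = ℕₚ.≤-trans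
    (ℕₚ.≤-reflexive (sym (trans (length-map side corners) #corners)))
    (unique⊆⇒length≤ (map⁺ side-injective (cartesianProduct⁺ (allFin⁺ #faces) (allFin⁺ 6))) sides-are-arcs)
    where
    corners : List (Fin #faces × Fin 6)
    corners = cartesianProduct (allFin #faces) (allFin 6)

    #corners : length corners ≡ #faces * 6
    #corners = trans (length-cartesianProduct (allFin #faces) (allFin 6))
      (cong (_* 6) (length-tabulate (λ (i : Fin #faces) → i)))

    sideDart : Fin #faces × Fin 6 → Dart G
    sideDart (f , i) = cycleDart G (proj₁ (hexagon f)) i

    side : Fin #faces × Fin 6 → Fin n × Fin n
    side c = source (sideDart c) , target (sideDart c)

    sideDart-face : ∀ f i → face (sideDart (f , i)) ≡ f
    sideDart-face f i = Equivalence.from (proj₂ (hexagon f) _) (i , refl)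

    side-injective : ∀ {c c′} → side c ≡ side c′ → c ≡ c′
    side-injective {f , i} {f′ , i′} eq
      with trans (sym (sideDart-face f i))
             (trans (cong face (dart-≡ G F (cong proj₁ eq) (cong proj₂ eq))) (sideDart-face f′ i′))
    ... | refl = cong (f ,_) (Cycle.injective (proj₁ (hexagon f)) (cong proj₁ eq))

    sides-are-arcs : ∀ {a} → a ∈ map side corners → a ∈ arcs []
    sides-are-arcs a∈ with ∈-map⁻ side a∈
    ... | (f , i) , _ , refl = ∈-arcs⁺ {[]} (Cycle.adjacent (proj₁ (hexagon f)) i , (λ ()) , λ ())

  -- Euler's formula with F faces gives 6n + 6F = 6|E| + 12 ≥ 9n + 12, whereas hexagons alone would
  -- give 6F ≤ 3n.
  ¬all-hexagons : ¬ (∀ f → BoundedByCycle 6 f)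
  ¬all-hexagons hexagon = ℕₚ.<⇒≱ (ℕₚ.m<m+n (6 * n + n * 3) (s≤s {n = 11} z≤n)) (begin
    6 * n + n * 3 + 12                            ≡⟨ regroup₁ n ⟩
    3 * (n * 3) + 12                              ≡⟨ cong (λ d → 3 * d + 12) (#arcs-cubic cubic) ⟨
    3 * #arcs [] + 12                             ≤⟨ ℕₚ.+-monoˡ-≤ 12 (ℕₚ.*-monoʳ-≤ 3 #arcs≤2#edges) ⟩
    3 * (length (edges G) + length (edges G)) + 12 ≡⟨ regroup₂ (length (edges G)) ⟩
    6 * (length (edges G) + 2)                    ≡⟨ cong (6 *_) euler ⟨
    6 * (n + #faces)                              ≡⟨ regroup₃ n #faces ⟩
    6 * n + #faces * 6                            ≤⟨ ℕₚ.+-monoʳ-≤ (6 * n) (hexagons-bound hexagon) ⟩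
    6 * n + #arcs []                              ≡⟨ cong (6 * n +_) (#arcs-cubic cubic) ⟩
    6 * n + n * 3                                 ∎)
    where
    open ℕₚ.≤-Reasoning
    regroup₁ : ∀ n → 6 * n + n * 3 + 12 ≡ 3 * (n * 3) + 12
    regroup₁ = solve-∀
    regroup₂ : ∀ e → 3 * (e + e) + 12 ≡ 6 * (e + 2)
    regroup₂ = solve-∀
    regroup₃ : ∀ n f → 6 * (n + f) ≡ 6 * n + f * 6
    regroup₃ = solve-∀

  pentagonalFace : ∃ λ f → BoundedByCycle 5 f
  -- The search inspects the tag of the given disjunction, which is decidable; if no tag is `inj₁`,
  -- every face comes with a bounding hexagon.
  pentagonalFace with Finₚ.any? (λ f → five? (pentagonOrHexagon f))
    where
    five? : ∀ {A B : Set} (s : A ⊎ B) → Dec (∃ λ a → s ≡ inj₁ a)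
    five? (inj₁ a) = yes (a , refl)
    five? (inj₂ b) = no λ ()
  ... | yes (f , B , _) = f , B
  ... | no ¬five = ⊥-elim (¬all-hexagons hexagon)
    where
    hexagon : ∀ f → BoundedByCycle 6 f
    hexagon f with pentagonOrHexagon f in eq
    ... | inj₁ B = ⊥-elim (¬five (f , B , eq))
    ... | inj₂ B = B

^-distribʳ-* : ∀ m n k → (m * n) ^ k ≡ m ^ k * n ^ k
^-distribʳ-* m n 0       = refl
^-distribʳ-* m n (suc k) = trans (cong (m * n *_) (^-distribʳ-* m n k))
  (ℕₚ.[m*n]*[o*p]≡[m*o]*[n*p] m n (m ^ k) (n ^ k))

-- Branching on the partner of a vertex

-- Bounds on eighth powers do not add up, but bounds `p * k ≤ r` do. The integer part of an eighth
-- root thus allows the counts of several branches to be summed within the natural numbers.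
eighth-root : ∀ Y → ∃ λ r → r ^ 8 ≤ Y × (∀ c → c ^ 8 ≤ Y → c ≤ r)
eighth-root 0 = 0 , z≤n , greatest
  where
  greatest : ∀ c → c ^ 8 ≤ 0 → c ≤ 0
  greatest 0       _ = z≤n
  greatest (suc c) p = contradiction (ℕₚ.m^n>0 (suc c) 8) (ℕₚ.≤⇒≯ p)
eighth-root (suc Y) with eighth-root Y
... | r , r⁸≤Y , greatest with suc r ^ 8 ≤? suc Y
...   | no ¬p = r , ℕₚ.m≤n⇒m≤1+n r⁸≤Y ,
    λ c c⁸≤ → ℕₚ.≮⇒≥ λ r<c → ¬p (ℕₚ.≤-trans (ℕₚ.^-monoˡ-≤ 8 r<c) c⁸≤)
...   | yes p = suc r , p , greatest′
  where
  greatest′ : ∀ c → c ^ 8 ≤ suc Y → c ≤ suc r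
  greatest′ 0       _   = z≤n
  greatest′ (suc c) c⁸≤ = s≤s (greatest c (ℕₚ.≤-pred (ℕₚ.≤-trans (ℕₚ.^-monoˡ-< 8 (ℕₚ.n<1+n c)) c⁸≤)))

scaled : ∀ p k {Y r} → (∀ c → c ^ 8 ≤ Y → c ≤ r) → p ^ 8 * k ^ 8 ≤ Y → p * k ≤ r
scaled p k {Y} greatest hp = greatest (p * k) (subst (_≤ Y) (sym (^-distribʳ-* p k 8)) hp)

-- The balanced case: a branch that deletes four edges, or eight arcs, gains 2 ^ 8 in the eighth
-- power and so contributes at most half.
halves : ∀ {m p q Y} → m ≤ p + q → p ^ 8 * 2 ^ 8 ≤ Y → q ^ 8 * 2 ^ 8 ≤ Y → m ^ 8 ≤ Y
halves {m} {p} {q} {Y} m≤ hp hq with eighth-root Y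
... | r , r⁸≤Y , greatest = ℕₚ.≤-trans (ℕₚ.^-monoˡ-≤ 8 (ℕₚ.*-cancelʳ-≤ m r 2 (begin
    m * 2          ≤⟨ ℕₚ.*-monoˡ-≤ 2 m≤ ⟩
    (p + q) * 2    ≡⟨ ℕₚ.*-distribʳ-+ 2 p q ⟩
    p * 2 + q * 2  ≤⟨ ℕₚ.+-mono-≤ (scaled p 2 greatest hp) (scaled q 2 greatest hq) ⟩
    r + r          ≡⟨ twice r ⟩
    r * 2          ∎))) r⁸≤Y
  where
  open ℕₚ.≤-Reasoning
  twice : ∀ t → t + t ≡ t * 2
  twice = solve-∀

-- 2^(−6/8) ≤ 3/5 and 2^(−12/8) ≤ 2/5.
threeFifths+twoFifths : ∀ {m p q Y} → m ≤ p + q → p ^ 8 * 2 ^ 6 ≤ Y → q ^ 8 * 2 ^ 12 ≤ Y → m ^ 8 ≤ Y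
threeFifths+twoFifths {m} {p} {q} {Y} m≤ hp hq with eighth-root (Y * 6 ^ 8)
... | r , r⁸≤ , greatest = ℕₚ.*-cancelʳ-≤ (m ^ 8) Y (6 ^ 8) (begin
    m ^ 8 * 6 ^ 8  ≡⟨ ^-distribʳ-* m 6 8 ⟨
    (m * 6) ^ 8    ≤⟨ ℕₚ.^-monoˡ-≤ 8 m*6≤r ⟩
    r ^ 8          ≤⟨ r⁸≤ ⟩
    Y * 6 ^ 8      ∎)
  where
  open ℕₚ.≤-Reasoning
  rescale : ∀ s u v → s ^ 8 * v ≤ Y → u ≤ v * 6 ^ 8 → s ^ 8 * u ≤ Y * 6 ^ 8
  rescale s u v hs u≤ = begin
    s ^ 8 * u           ≤⟨ ℕₚ.*-monoʳ-≤ (s ^ 8) u≤ ⟩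
    s ^ 8 * (v * 6 ^ 8) ≡⟨ ℕₚ.*-assoc (s ^ 8) v (6 ^ 8) ⟨
    s ^ 8 * v * 6 ^ 8   ≤⟨ ℕₚ.*-monoˡ-≤ (6 ^ 8) hs ⟩
    Y * 6 ^ 8           ∎
  m*6≤r : m * 6 ≤ r
  m*6≤r = ℕₚ.*-cancelʳ-≤ (m * 6) r 5 (begin
    m * 6 * 5               ≤⟨ ℕₚ.*-monoˡ-≤ 5 (ℕₚ.*-monoˡ-≤ 6 m≤) ⟩
    (p + q) * 6 * 5         ≡⟨ regroup p q ⟩
    -- The common factor 6 makes 6 · 5/3 = 10 and 6 · 5/2 = 15 integers. The numerical facts behind
    -- the fractions are (10/6) ^ 8 ≤ 2 ^ 6 and (15/6) ^ 8 ≤ 2 ^ 12.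
    p * 10 * 3 + q * 15 * 2 ≤⟨ ℕₚ.+-mono-≤
      (ℕₚ.*-monoˡ-≤ 3 (scaled p 10 greatest (rescale p (10 ^ 8) (2 ^ 6) hp
        (ℕₚ.≤ᵇ⇒≤ (10 ^ 8) (2 ^ 6 * 6 ^ 8) _))))
      (ℕₚ.*-monoˡ-≤ 2 (scaled q 15 greatest (rescale q (15 ^ 8) (2 ^ 12) hq
        (ℕₚ.≤ᵇ⇒≤ (15 ^ 8) (2 ^ 12 * 6 ^ 8) _)))) ⟩
    r * 3 + r * 2           ≡⟨ ℕₚ.*-distribˡ-+ r 3 2 ⟨
    r * 5                   ∎)
    where
    regroup : ∀ p q → (p + q) * 6 * 5 ≡ p * 10 * 3 + q * 15 * 2
    regroup = solve-∀

shrink : ∀ p k {d D} → p ^ 8 ≤ 2 ^ d → d + k ≤ D → p ^ 8 * 2 ^ k ≤ 2 ^ D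
shrink p k {d} {D} hp d+k≤D = begin
  p ^ 8 * 2 ^ k  ≤⟨ ℕₚ.*-monoˡ-≤ (2 ^ k) hp ⟩
  2 ^ d * 2 ^ k  ≡⟨ ℕₚ.^-distribˡ-+-* 2 d k ⟨
  2 ^ (d + k)    ≤⟨ ℕₚ.^-monoʳ-≤ 2 d+k≤D ⟩
  2 ^ D          ∎
  where open ℕₚ.≤-Reasoning

-- Arcs lost by deleting vertices

module Deletion {n : ℕ} (G : SimpleGraph n) where
  open SimpleGraph G
  open Residual G

  -- A record, so that Agda can infer R′ and R.
  record Drop (R′ : List (Fin n)) (k : ℕ) (R : List (Fin n)) : Set where
    constructor drop
    field fewer-arcs : #arcs R′ + k ≤ #arcs R
  open Drop public

  infixr 5 _⨾_
  -- Chains read backwards: the leftmost factor is the last deletion.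
  _⨾_ : ∀ {R₁ R₂ R₃ i j} → Drop R₁ i R₂ → Drop R₂ j R₃ → Drop R₁ (i + j) R₃
  _⨾_ {R₁} {i = i} {j} (drop p) (drop q) = drop (ℕₚ.≤-trans
    (ℕₚ.≤-trans (ℕₚ.≤-reflexive (sym (ℕₚ.+-assoc (#arcs R₁) i j))) (ℕₚ.+-monoˡ-≤ j p)) q)

  #arcs-antitone : ∀ {v R} → #arcs (v ∷ R) ≤ #arcs R
  #arcs-antitone {v} {R} = unique⊆⇒length≤ (arcs-unique (v ∷ R)) smaller
    where
    smaller : ∀ {a} → a ∈ arcs (v ∷ R) → a ∈ arcs R
    smaller a∈ with ∈-arcs⁻ {v ∷ R} a∈
    ... | e , u∉ , w∉ = ∈-arcs⁺ {R} (e , u∉ ∘ there , w∉ ∘ there)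

  -- The arcs from `v` to `xs` and those back are disjoint, as no vertex is its own neighbour, and
  -- both kinds are missing from `arcs (v ∷ R)`. Every listed neighbour therefore counts twice.
  delete : ∀ {v R} (xs : List (Fin n)) → v ∉ R → Unique xs →
    (∀ {w} → w ∈ xs → v ~ w × w ∉ R) →
    Drop (v ∷ R) (length xs + length xs) R
  delete {v} {R} xs v∉R uniq adj = drop (ℕₚ.≤-trans (ℕₚ.≤-reflexive (sym lengths))
    (unique⊆⇒length≤ {ys = arcs R}
      (++⁺ (arcs-unique (v ∷ R))
        (++⁺ (map⁺ {f = v ,_} (cong proj₂) uniq) (map⁺ {f = _, v} (cong proj₁) uniq) disjoint₂) disjoint₁)
      within))
    where
    out = map (v ,_) xs
    inn = map (_, v) xs

    lengths : length (arcs (v ∷ R) ++ out ++ inn) ≡ #arcs (v ∷ R) + (length xs + length xs)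
    lengths = trans (length-++ (arcs (v ∷ R))) (cong (#arcs (v ∷ R) +_)
      (trans (length-++ out) (cong₂ _+_ (length-map (v ,_) xs) (length-map (_, v) xs))))

    disjoint₂ : ∀ {a} → ¬ (a ∈ out × a ∈ inn)
    disjoint₂ (p , q) with ∈-map⁻ (v ,_) p | ∈-map⁻ (_, v) q
    ... | w , w∈ , refl | _ , _ , refl = ~-irr (proj₁ (adj w∈))

    disjoint₁ : ∀ {a} → ¬ (a ∈ arcs (v ∷ R) × a ∈ out ++ inn)
    disjoint₁ (p , q) with ∈-++⁻ out q
    ... | inj₁ q′ with ∈-map⁻ (v ,_) q′
    ...   | _ , _ , refl = proj₁ (proj₂ (∈-arcs⁻ {v ∷ R} p)) (here refl)
    disjoint₁ (p , q) | inj₂ q′ with ∈-map⁻ (_, v) q′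
    ...   | _ , _ , refl = proj₂ (proj₂ (∈-arcs⁻ {v ∷ R} p)) (here refl)

    within : ∀ {a} → a ∈ arcs (v ∷ R) ++ out ++ inn → a ∈ arcs R
    within a∈ with ∈-++⁻ (arcs (v ∷ R)) a∈
    ... | inj₁ p with ∈-arcs⁻ {v ∷ R} p
    ...   | e , u∉ , w∉ = ∈-arcs⁺ {R} (e , u∉ ∘ there , w∉ ∘ there)
    within a∈ | inj₂ p with ∈-++⁻ out p
    ...   | inj₁ q with ∈-map⁻ (v ,_) q
    ...     | w , w∈ , refl = ∈-arcs⁺ {R} (proj₁ (adj w∈) , v∉R , proj₂ (adj w∈))
    within a∈ | inj₂ p | inj₂ q with ∈-map⁻ (_, v) q
    ...     | w , w∈ , refl = ∈-arcs⁺ {R} (~-sym (proj₁ (adj w∈)) , proj₂ (adj w∈) , v∉R)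

  delete₀ : ∀ {v R} → Drop (v ∷ R) 0 R
  delete₀ = drop (ℕₚ.≤-trans (ℕₚ.≤-reflexive (ℕₚ.+-identityʳ _)) #arcs-antitone)

  delete₁ : ∀ {v R x} → v ∉ R → v ~ x → x ∉ R → Drop (v ∷ R) 2 R
  delete₁ {x = x} v∉R e x∉R = delete (x ∷ []) v∉R ([] ∷ []) λ { (here refl) → e , x∉R }

  delete₂ : ∀ {v R x y} → v ∉ R → x ≢ y → v ~ x → x ∉ R → v ~ y → y ∉ R → Drop (v ∷ R) 4 R
  delete₂ {x = x} {y} v∉R x≢y e x∉R e′ y∉R = delete (x ∷ y ∷ []) v∉R ((x≢y ∷ []) ∷ [] ∷ [])
    λ { (here refl) → e , x∉R ; (there (here refl)) → e′ , y∉R }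

  delete₃ : ∀ {v R x y z} → v ∉ R → x ≢ y → x ≢ z → y ≢ z →
    v ~ x → x ∉ R → v ~ y → y ∉ R → v ~ z → z ∉ R → Drop (v ∷ R) 6 R
  delete₃ {x = x} {y} {z} v∉R x≢y x≢z y≢z e x∉R e′ y∉R e″ z∉R =
    delete (x ∷ y ∷ z ∷ []) v∉R ((x≢y ∷ x≢z ∷ []) ∷ (y≢z ∷ []) ∷ [] ∷ [])
      λ { (here refl) → e , x∉R ; (there (here refl)) → e′ , y∉R ; (there (there (here refl))) → e″ , z∉R }

  residualNeighbours : List (Fin n) → Fin n → List (Fin n)
  residualNeighbours R v = filter (λ w → (v ~? w) ×-dec ¬? (member? _≟_ w R)) (allFin n)

  ∈-residual⁺ : ∀ {R v w} → v ~ w → w ∉ R → w ∈ residualNeighbours R v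
  ∈-residual⁺ {R} {v} e w∉R = ∈-filter⁺ (λ w → (v ~? w) ×-dec ¬? (member? _≟_ w R)) (∈-allFin _) (e , w∉R)

  residual-unique : ∀ R v → Unique (residualNeighbours R v)
  residual-unique R v = filter⁺ (λ w → (v ~? w) ×-dec ¬? (member? _≟_ w R)) (allFin⁺ n)

  -- Most uses ask only for two distinct neighbours, hence the joint constructor `several`; its last
  -- argument separates exactly two from at least three.
  data ResidualDegree (R : List (Fin n)) (v : Fin n) : Set where
    none : (∀ {w} → v ~ w → w ∉ R → ⊥) → ResidualDegree R v
    one  : ∀ {x} → v ~ x → x ∉ R → (∀ {w} → v ~ w → w ∉ R → w ≡ x) → ResidualDegree R v
    several : ∀ {x y} → x ≢ y → v ~ x → x ∉ R → v ~ y → y ∉ R →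
      (∀ {w} → v ~ w → w ∉ R → w ≡ x ⊎ w ≡ y) ⊎ (∃ λ z → x ≢ z × y ≢ z × v ~ z × z ∉ R) →
      ResidualDegree R v

  residual-degree : ∀ R v → ResidualDegree R v
  residual-degree R v = classify (residualNeighbours R v) (residual-unique R v)
    (λ w∈ → proj₂ (∈-filter⁻ (λ w → (v ~? w) ×-dec ¬? (member? _≟_ w R)) {xs = allFin n} w∈))
    ∈-residual⁺
    where
    classify : ∀ xs → Unique xs → (∀ {w} → w ∈ xs → v ~ w × w ∉ R) →
      (∀ {w} → v ~ w → w ∉ R → w ∈ xs) → ResidualDegree R v
    classify [] _ _ complete = none λ e w∉ → case complete e w∉ of λ ()
    classify (x ∷ []) _ sound complete = one (proj₁ (sound (here refl))) (proj₂ (sound (here refl)))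
      λ e w∉ → case complete e w∉ of λ { (here eq) → eq }
    classify (x ∷ y ∷ []) ((x≢y ∷ []) ∷ _) sound complete =
      several x≢y (proj₁ (sound (here refl))) (proj₂ (sound (here refl)))
        (proj₁ (sound (there (here refl)))) (proj₂ (sound (there (here refl))))
        (inj₁ λ e w∉ → case complete e w∉ of λ { (here eq) → inj₁ eq ; (there (here eq)) → inj₂ eq })
    classify (x ∷ y ∷ z ∷ _) ((x≢y ∷ x≢z ∷ _) ∷ (y≢z ∷ _) ∷ _) sound _ =
      several x≢y (proj₁ (sound (here refl))) (proj₂ (sound (here refl)))
        (proj₁ (sound (there (here refl)))) (proj₂ (sound (there (here refl))))
        (inj₂ (z , x≢z , y≢z , sound (there (there (here refl)))))

-- X is a type of codes for perfect matchings, each of them seen as the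
-- involution mate that exchanges the ends of its edges.
module Branching {n : ℕ} (G : SimpleGraph n) (cubic : Cubic G) (connected : Connected G)
                 {X : Set} (mate : X → Fin n → Fin n) where
  open SimpleGraph G
  open Residual G
  open Deletion G

  -- The matchings in Ms induce one and the same perfect matching on R, so that
  -- they correspond to perfect matchings of the graph without R.
  record Extensions (R : List (Fin n)) (Ms : List X) : Set where
    field
      unique      : Unique Ms
      matched     : ∀ {M} → M ∈ Ms → ∀ v → v ~ mate M v
      involutive  : ∀ {M} → M ∈ Ms → ∀ v → mate M (mate M v) ≡ v
      extensional : ∀ {M M′} → M ∈ Ms → M′ ∈ Ms → (∀ v → mate M v ≡ mate M′ v) → M ≡ M′
      agree       : ∀ {M M′ v} → M ∈ Ms → M′ ∈ Ms → v ∈ R → mate M v ≡ mate M′ v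
      closed      : ∀ {M v} → M ∈ Ms → v ∈ R → mate M v ∈ R

    mate-sym : ∀ {M u v} → M ∈ Ms → mate M u ≡ v → mate M v ≡ u
    mate-sym M∈ refl = involutive M∈ _

    mate∉ : ∀ {M v} → M ∈ Ms → v ∉ R → mate M v ∉ R
    mate∉ M∈ v∉ m∈ = v∉ (subst (_∈ R) (involutive M∈ _) (closed M∈ m∈))

  select : Fin n → Fin n → List X → List X
  select u v = filter (λ M → mate M u ≟ v)

  ∈-select⁺ : ∀ {u v Ms M} → M ∈ Ms → mate M u ≡ v → M ∈ select u v Ms
  ∈-select⁺ {u} {v} = ∈-filter⁺ (λ M → mate M u ≟ v)

  ∈-select⁻ : ∀ {u v Ms M} → M ∈ select u v Ms → M ∈ Ms × mate M u ≡ v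
  ∈-select⁻ {u} {v} {Ms} = ∈-filter⁻ (λ M → mate M u ≟ v) {xs = Ms}

  -- Fixing the partner of `u` also fixes that of `v`, by involutivity, so both vertices can join
  -- the deleted set.
  select-extensions : ∀ {R Ms} u v → Extensions R Ms → Extensions (v ∷ u ∷ R) (select u v Ms)
  select-extensions {R} {Ms} u v ext = record
    { unique      = filter⁺ (λ M → mate M u ≟ v) unique
    ; matched     = matched ∘ inside
    ; involutive  = involutive ∘ inside
    ; extensional = λ M∈ M′∈ → extensional (inside M∈) (inside M′∈)
    ; agree       = agree′
    ; closed      = closed′
    }
    where
    open Extensions ext
    inside : ∀ {M} → M ∈ select u v Ms → M ∈ Ms
    inside = proj₁ ∘ ∈-select⁻
    uv : ∀ {M} → M ∈ select u v Ms → mate M u ≡ v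
    uv = proj₂ ∘ ∈-select⁻ {Ms = Ms}
    vu : ∀ {M} → M ∈ select u v Ms → mate M v ≡ u
    vu M∈ = mate-sym (inside M∈) (uv M∈)

    agree′ : ∀ {M M′ w} → M ∈ select u v Ms → M′ ∈ select u v Ms → w ∈ v ∷ u ∷ R → mate M w ≡ mate M′ w
    agree′ M∈ M′∈ (here refl)         = trans (vu M∈) (sym (vu M′∈))
    agree′ M∈ M′∈ (there (here refl)) = trans (uv M∈) (sym (uv M′∈))
    agree′ M∈ M′∈ (there (there w∈))  = agree (inside M∈) (inside M′∈) w∈

    closed′ : ∀ {M w} → M ∈ select u v Ms → w ∈ v ∷ u ∷ R → mate M w ∈ v ∷ u ∷ R
    closed′ M∈ (here refl)         = there (here (vu M∈))
    closed′ M∈ (there (here refl)) = here (uv M∈)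
    closed′ M∈ (there (there w∈))  = there (there (closed (inside M∈) w∈))

  unique⊆∪⇒length≤ : ∀ {Ms As Bs : List X} → Unique Ms → (∀ {M} → M ∈ Ms → M ∈ As ⊎ M ∈ Bs) →
    length Ms ≤ length As + length Bs
  unique⊆∪⇒length≤ {Ms} {As} {Bs} uniq split = subst (length Ms ≤_) (length-++ As {Bs})
    (unique⊆⇒length≤ {ys = As ++ Bs} uniq λ M∈ → Sum.[ ∈-++⁺ˡ , ∈-++⁺ʳ As ]′ (split M∈))

  -- Since `#arcs` counts each edge twice, this is the bound 2 ^ (e / 4) for e remaining edges,
  -- raised to the eighth power.
  Bounded : List (Fin n) → List X → Set
  Bounded R Ms = length Ms ^ 8 ≤ 2 ^ #arcs R

  bounded-if-all-deleted : ∀ {R Ms} → Extensions R Ms → (∀ v → v ∈ R) → Bounded R Ms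
  bounded-if-all-deleted {R} {Ms} ext all = ℕₚ.≤-trans
    (ℕₚ.^-monoˡ-≤ 8 (atMostOne Ms unique extensional′)) (ℕₚ.m^n>0 2 (#arcs R))
    where
    open Extensions ext
    extensional′ : ∀ {M M′} → M ∈ Ms → M′ ∈ Ms → M ≡ M′
    extensional′ M∈ M′∈ = extensional M∈ M′∈ λ v → agree M∈ M′∈ (all v)
    atMostOne : ∀ (Ms : List X) → Unique Ms → (∀ {M M′} → M ∈ Ms → M′ ∈ Ms → M ≡ M′) → length Ms ≤ 1
    atMostOne []          _ _ = z≤n
    atMostOne (_ ∷ [])    _ _ = s≤s z≤n
    atMostOne (_ ∷ _ ∷ _) ((p ∷ _) ∷ _) same = ⊥-elim (p (same (here refl) (there (here refl))))

  module Step {R : List (Fin n)} {Ms : List X} (ext : Extensions R Ms)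
    (ih : ∀ {R′ Ms′} → #arcs R′ < #arcs R → (∃ λ r → r ∈ R′) → Extensions R′ Ms′ → Bounded R′ Ms′) where
    open Extensions ext

    smaller : ∀ {R′ k} → Drop R′ (suc k) R → #arcs R′ < #arcs R
    smaller {R′} {k} (drop p) = ℕₚ.≤-trans
      (ℕₚ.≤-trans (s≤s (ℕₚ.m≤m+n (#arcs R′) k)) (ℕₚ.≤-reflexive (sym (ℕₚ.+-suc (#arcs R′) k)))) p

    branch : ∀ {v R′ k} Ms′ → Extensions (v ∷ R′) Ms′ → Drop (v ∷ R′) (suc k) R →
      length Ms′ ^ 8 * 2 ^ suc k ≤ 2 ^ #arcs R
    branch {k = k} Ms′ ext′ d = shrink (length Ms′) (suc k) (ih (smaller d) (_ , here refl) ext′) (fewer-arcs d)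

    halved : ∀ {u v R₁ R₂} As Bs → (∀ {M} → M ∈ Ms → M ∈ As ⊎ M ∈ Bs) →
      Extensions (u ∷ R₁) As → Drop (u ∷ R₁) 8 R →
      Extensions (v ∷ R₂) Bs → Drop (v ∷ R₂) 8 R → Bounded R Ms
    halved As Bs split eA dA eB dB = halves {p = length As} {length Bs}
      (unique⊆∪⇒length≤ {As = As} {Bs} unique split) (branch As eA dA) (branch Bs eB dB)

    -- Selecting a partner shared by all the matchings loses none of them, while at least the edge
    -- uv disappears; induction gives even more than is claimed.
    forced : ∀ {u v} → u ∉ R → u ~ v → v ∉ R → (∀ {M} → M ∈ Ms → mate M u ≡ v) → Bounded R Ms
    forced {u} {v} u∉ e v∉ all = ℕₚ.≤-trans
      (ℕₚ.^-monoˡ-≤ 8 (unique⊆⇒length≤ unique λ M∈ → ∈-select⁺ M∈ (all M∈)))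
      (ℕₚ.≤-trans (ih (smaller two-fewer) (_ , here refl) (select-extensions u v ext))
        (ℕₚ.^-monoʳ-≤ 2 (ℕₚ.≤-trans (ℕₚ.m≤m+n _ 2) (fewer-arcs two-fewer))))
      where
      two-fewer : Drop (v ∷ u ∷ R) 2 R
      two-fewer = delete₀ ⨾ delete₁ u∉ e v∉

    ∉-∷ : ∀ {u v : Fin n} {R′} → u ≢ v → u ∉ R′ → u ∉ v ∷ R′
    ∉-∷ u≢v u∉ (here eq)  = u≢v eq
    ∉-∷ u≢v u∉ (there u∈) = u∉ u∈

    ~⇒≢ : ∀ {u v} → u ~ v → u ≢ v
    ~⇒≢ e refl = ~-irr e

    -- The residual graph contains the path b y a c, in which y and a have degree two.
    record Path (b y a c : Fin n) : Set where
      field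
        y∉R : y ∉ R
        a∉R : a ∉ R
        b∉R : b ∉ R
        c∉R : c ∉ R
        y~a : y ~ a
        y~b : y ~ b
        a~c : a ~ c
        a≢b : a ≢ b
        c≢y : c ≢ y
        at-y : ∀ {w} → y ~ w → w ∉ R → w ≡ a ⊎ w ≡ b
        at-a : ∀ {w} → a ~ w → w ∉ R → w ≡ y ⊎ w ≡ c

      mate-y : ∀ {M} → M ∈ Ms → mate M y ≡ a ⊎ mate M y ≡ b
      mate-y M∈ = at-y (matched M∈ y) (mate∉ M∈ y∉R)

      mate-a : ∀ {M} → M ∈ Ms → mate M a ≡ y ⊎ mate M a ≡ c
      mate-a M∈ = at-a (matched M∈ a) (mate∉ M∈ a∉R)

      mate-a-outer : ∀ {M} → M ∈ Ms → mate M y ≡ b → mate M a ≡ c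
      mate-a-outer M∈ yb with mate-a M∈
      ... | inj₁ ay = ⊥-elim (a≢b (trans (sym (mate-sym M∈ ay)) yb))
      ... | inj₂ ac = ac

    reverse : ∀ {b y a c} → Path b y a c → Path c a y b
    reverse p = record
      { y∉R = a∉R ; a∉R = y∉R ; b∉R = c∉R ; c∉R = b∉R ; y~a = ~-sym y~a ; y~b = a~c ; a~c = y~b
      ; a≢b = c≢y ∘ sym ; c≢y = a≢b ∘ sym ; at-y = at-a ; at-a = at-y }
      where open Path p

    module _ {b y a c} (p : Path b y a c) where
      open Path p

      -- If y were matched to b, then a would have to be matched to c, which is the same vertex.
      -- Hence y is always matched to a.
      closed-path : c ≡ b → Bounded R Ms
      closed-path refl = forced y∉R y~a a∉R λ M∈ → case mate-y M∈ of λ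
        { (inj₁ ya) → ya
        ; (inj₂ yb) → ⊥-elim (~⇒≢ y~a (trans (sym (mate-sym M∈ yb)) (mate-sym M∈ (mate-a-outer M∈ yb)))) }

      -- Here b has degree two as well, so the path x b y a c has three inner vertices, and either
      -- choice for y forces a second matching edge. Both branches delete its four edges and are
      -- balanced.
      three-inner : c ≢ b → ∀ {x} → b ~ x → x ∉ y ∷ R → (∀ {w} → b ~ w → w ∉ y ∷ R → w ≡ x) → Bounded R Ms
      three-inner c≢b {x} b~x x∉ only = halved
        (select b x (select y a Ms)) (select a c (select y b Ms)) split
        (select-extensions b x (select-extensions y a ext))
        (delete₀ ⨾ delete₁ b∉₃ b~x (∉-∷ x≢a x∉) ⨾ delete₁ a∉₂ a~c (∉-∷ c≢y c∉R)
         ⨾ delete₂ y∉R a≢b y~a a∉R y~b b∉R)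
        (select-extensions a c (select-extensions y b ext))
        (delete₀ ⨾ delete₁ (∉-∷ a≢b a∉₂) a~c (∉-∷ c≢b (∉-∷ c≢y c∉R))
         ⨾ delete₁ (∉-∷ (~⇒≢ (~-sym y~b)) b∉R) b~x x∉ ⨾ delete₂ y∉R a≢b y~a a∉R y~b b∉R)
        where
        a∉₂ : a ∉ y ∷ R
        a∉₂ = ∉-∷ (~⇒≢ (~-sym y~a)) a∉R
        b∉₃ : b ∉ a ∷ y ∷ R
        b∉₃ = ∉-∷ (a≢b ∘ sym) (∉-∷ (~⇒≢ (~-sym y~b)) b∉R)
        x≢a : x ≢ a
        x≢a refl with at-a (~-sym b~x) b∉R
        ... | inj₁ b≡y = ~⇒≢ y~b (sym b≡y)
        ... | inj₂ b≡c = c≢b (sym b≡c)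
        split : ∀ {M} → M ∈ Ms → M ∈ select b x (select y a Ms) ⊎ M ∈ select a c (select y b Ms)
        split {M} M∈ with mate-y M∈
        ... | inj₂ yb = inj₂ (∈-select⁺ (∈-select⁺ M∈ yb) (mate-a-outer M∈ yb))
        ... | inj₁ ya = inj₁ (∈-select⁺ (∈-select⁺ M∈ ya) (only (matched M∈ b) (∉-∷ not-y (mate∉ M∈ b∉R))))
          where
          not-y : mate M b ≢ y
          not-y by = a≢b (trans (sym ya) (mate-sym M∈ by))

      dead-end : (∀ {w} → b ~ w → w ∉ y ∷ R → ⊥) → Bounded R Ms
      dead-end isolated = forced b∉R (~-sym y~b) y∉R λ {M} M∈ →
        decidable-stable (mate M b ≟ y) λ b≢y → isolated (matched M∈ b) (∉-∷ b≢y (mate∉ M∈ b∉R))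

      -- The unbalanced case. Matching y with a deletes ya, yb and ac. Matching y with b forces ac
      -- and deletes in addition the two further edges at b and the edge cz, six in all; `z ≢ b`
      -- keeps cz from being counted already at b.
      open-ends : c ≢ b →
        ∀ {x₁ x₂} → x₁ ≢ x₂ → b ~ x₁ → x₁ ∉ y ∷ R → b ~ x₂ → x₂ ∉ y ∷ R →
        ∀ {z} → z ≢ b → c ~ z → z ∉ a ∷ R → Bounded R Ms
      open-ends c≢b x₁≢x₂ b~x₁ x₁∉ b~x₂ x₂∉ {z} z≢b c~z z∉ = threeFifths+twoFifths {p = length As} {length Bs}
        (unique⊆∪⇒length≤ {As = As} {Bs} unique split)
        (branch As (select-extensions y a ext)
          (delete₁ a∉₂ a~c (∉-∷ c≢y c∉R) ⨾ delete₂ y∉R a≢b y~a a∉R y~b b∉R))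
        (branch Bs (select-extensions a c (select-extensions y b ext))
          (delete₁ (∉-∷ (~⇒≢ (~-sym a~c)) (∉-∷ c≢b (∉-∷ c≢y c∉R))) c~z z∉₄
           ⨾ delete₁ (∉-∷ a≢b a∉₂) a~c (∉-∷ c≢b (∉-∷ c≢y c∉R))
           ⨾ delete₂ (∉-∷ (~⇒≢ (~-sym y~b)) b∉R) x₁≢x₂ b~x₁ x₁∉ b~x₂ x₂∉
           ⨾ delete₂ y∉R a≢b y~a a∉R y~b b∉R))
        where
        a∉₂ : a ∉ y ∷ R
        a∉₂ = ∉-∷ (~⇒≢ (~-sym y~a)) a∉R
        As = select y a Ms
        Bs = select a c (select y b Ms)
        z≢y : z ≢ y
        z≢y refl with at-y (~-sym c~z) c∉R
        ... | inj₁ c≡a = ~⇒≢ a~c (sym c≡a)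
        ... | inj₂ c≡b = c≢b c≡b
        z∉₄ : z ∉ a ∷ b ∷ y ∷ R
        z∉₄ = ∉-∷ (z∉ ∘ here) (∉-∷ z≢b (∉-∷ z≢y (z∉ ∘ there)))
        split : ∀ {M} → M ∈ Ms → M ∈ As ⊎ M ∈ Bs
        split M∈ with mate-y M∈
        ... | inj₁ ya = inj₁ (∈-select⁺ M∈ ya)
        ... | inj₂ yb = inj₂ (∈-select⁺ (∈-select⁺ M∈ yb) (mate-a-outer M∈ yb))

    open-path : ∀ {b y a c} → Path b y a c → c ≢ b →
      ∀ {x₁ x₂} → x₁ ≢ x₂ → b ~ x₁ → x₁ ∉ y ∷ R → b ~ x₂ → x₂ ∉ y ∷ R → Bounded R Ms
    open-path {b} {y} {a} {c} p c≢b x₁≢x₂ b~x₁ x₁∉ b~x₂ x₂∉ with residual-degree (a ∷ R) c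
    ... | none no-z        = dead-end (reverse p) no-z
    ... | one c~z z∉ only  = three-inner (reverse p) (c≢b ∘ sym) c~z z∉ only
    -- Of two distinct further neighbours of c, at least one differs from b.
    ... | several {z₁} {z₂} z₁≢z₂ c~z₁ z₁∉ c~z₂ z₂∉ _ with z₁ ≟ b
    ...   | no z₁≢b  = open-ends p c≢b x₁≢x₂ b~x₁ x₁∉ b~x₂ x₂∉ z₁≢b c~z₁ z₁∉
    ...   | yes refl = open-ends p c≢b x₁≢x₂ b~x₁ x₁∉ b~x₂ x₂∉ (z₁≢z₂ ∘ sym) c~z₂ z₂∉

    path-bounded : ∀ {b y a c} → Path b y a c → Bounded R Ms
    path-bounded {b} {y} {a} {c} p with c ≟ b
    ... | yes c≡b = closed-path p c≡b
    ... | no c≢b with residual-degree (y ∷ R) b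
    ...   | none no-x       = dead-end p no-x
    ...   | one b~x x∉ only = three-inner p c≢b b~x x∉ only
    ...   | several x₁≢x₂ b~x₁ x₁∉ b~x₂ x₂∉ _ = open-path p c≢b x₁≢x₂ b~x₁ x₁∉ b~x₂ x₂∉

    at-degree-two : ∀ {a y c} → (∀ {w} → a ~ w → w ∉ y ∷ R → w ≡ c) →
      ∀ {w} → a ~ w → w ∉ R → w ≡ y ⊎ w ≡ c
    at-degree-two {y = y} only {w} e w∉ with w ≟ y
    ... | yes w≡y = inj₁ w≡y
    ... | no w≢y  = inj₂ (only e (∉-∷ w≢y w∉))

    step-bounded : ∀ {x y} → x ∈ R → y ∉ R → x ~ y → Bounded R Ms
    step-bounded {x} {y} x∈R y∉R x~y with residual-degree R y
    ... | none isolated = ℕₚ.≤-trans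
            (ℕₚ.^-monoˡ-≤ 8 (unique⊆⇒length≤ {ys = []} unique λ M∈ → ⊥-elim (isolated (matched M∈ y) (mate∉ M∈ y∉R))))
            z≤n
    ... | one y~a a∉R only = forced y∉R y~a a∉R λ M∈ → only (matched M∈ y) (mate∉ M∈ y∉R)
    -- Three remaining neighbours together with the deleted neighbour x would give y degree four.
    ... | several {a} {b} a≢b y~a a∉R y~b b∉R (inj₂ (c , a≢c , b≢c , y~c , c∉R)) =
      contradiction (degree-bound G cubic {y} {x ∷ a ∷ b ∷ c ∷ []} uniq adj) λ { (s≤s (s≤s (s≤s ()))) }
      where
      x≢ : ∀ {w} → w ∉ R → x ≢ w
      x≢ w∉ refl = w∉ x∈R
      uniq : Unique (x ∷ a ∷ b ∷ c ∷ [])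
      uniq = (x≢ a∉R ∷ x≢ b∉R ∷ x≢ c∉R ∷ []) ∷ (a≢b ∷ a≢c ∷ []) ∷ (b≢c ∷ []) ∷ [] ∷ []
      adj : ∀ {w} → w ∈ x ∷ a ∷ b ∷ c ∷ [] → y ~ w
      adj (here refl)                         = ~-sym x~y
      adj (there (here refl))                 = y~a
      adj (there (there (here refl)))         = y~b
      adj (there (there (there (here refl)))) = y~c
    ... | several {a} {b} a≢b y~a a∉R y~b b∉R (inj₁ only)
        with residual-degree (y ∷ R) a | residual-degree (y ∷ R) b
    ...   | none no-x | _ = forced a∉R (~-sym y~a) y∉R (λ {M} M∈ →
              decidable-stable (mate M a ≟ y) λ a≢y → no-x (matched M∈ a) (∉-∷ a≢y (mate∉ M∈ a∉R)))
    ...   | one a~c c∉ only-c | _ = path-bounded record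
              { y∉R = y∉R ; a∉R = a∉R ; b∉R = b∉R ; c∉R = c∉ ∘ there ; y~a = y~a ; y~b = y~b ; a~c = a~c
              ; a≢b = a≢b ; c≢y = c∉ ∘ here ; at-y = only
              ; at-a = λ {w} e w∉ → at-degree-two only-c e w∉ }
    ...   | several _ _ _ _ _ _ | none no-x = forced b∉R (~-sym y~b) y∉R (λ {M} M∈ →
              decidable-stable (mate M b ≟ y) λ b≢y → no-x (matched M∈ b) (∉-∷ b≢y (mate∉ M∈ b∉R)))
    ...   | several _ _ _ _ _ _ | one b~c c∉ only-c = path-bounded record
              { y∉R = y∉R ; a∉R = b∉R ; b∉R = a∉R ; c∉R = c∉ ∘ there ; y~a = y~b ; y~b = y~a ; a~c = b~c
              ; a≢b = a≢b ∘ sym ; c≢y = c∉ ∘ here ; at-y = λ e w∉ → Sum.swap (only e w∉)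
              ; at-a = at-degree-two only-c }
    -- Either partner takes with it the two edges at y and two further edges of its own, four in
    -- each branch.
    ...   | several p₁ a~s s∉ a~t t∉ _ | several p₂ b~s′ s′∉ b~t′ t′∉ _ = halved
              (select y a Ms) (select y b Ms) split
              (select-extensions y a ext)
              (delete₂ (∉-∷ (~⇒≢ (~-sym y~a)) a∉R) p₁ a~s s∉ a~t t∉ ⨾ delete₂ y∉R a≢b y~a a∉R y~b b∉R)
              (select-extensions y b ext)
              (delete₂ (∉-∷ (~⇒≢ (~-sym y~b)) b∉R) p₂ b~s′ s′∉ b~t′ t′∉ ⨾ delete₂ y∉R a≢b y~a a∉R y~b b∉R)
      where
      split : ∀ {M} → M ∈ Ms → M ∈ select y a Ms ⊎ M ∈ select y b Ms
      split M∈ = Sum.map (∈-select⁺ M∈) (∈-select⁺ M∈) (only (matched M∈ y) (mate∉ M∈ y∉R))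

  bounded-acc : ∀ {R Ms} → Acc _<_ (#arcs R) → (∃ λ r → r ∈ R) → Extensions R Ms → Bounded R Ms
  bounded-acc {R} {Ms} (acc smaller) (r , r∈R) ext with Finₚ.any? (λ v → ¬? (member? _≟_ v R))
  ... | no ∄v = bounded-if-all-deleted ext λ v → decidable-stable (member? _≟_ v R) λ v∉ → ∄v (v , v∉)
  -- A walk from a deleted vertex to a remaining one crosses an edge xy between the two kinds; its
  -- end y has lost a neighbour and is the vertex to branch on.
  ... | yes (v , v∉R) with crossing (connected r v) r∈R v∉R
    where
    crossing : ∀ {u v} → Star _~_ u v → u ∈ R → v ∉ R → ∃ λ x → ∃ λ y → x ∈ R × y ∉ R × x ~ y
    crossing ε u∈ v∉ = ⊥-elim (v∉ u∈)
    crossing {u} (_◅_ {j = w} u~w walk) u∈ v∉ with member? _≟_ w R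
    ... | yes w∈ = crossing walk w∈ v∉
    ... | no w∉  = u , w , u∈ , w∉ , u~w
  ...   | x , y , x∈ , y∉ , x~y = Step.step-bounded ext (λ lt → bounded-acc (smaller lt)) x∈ y∉ x~y

  bounded : ∀ {r R Ms} → Extensions (r ∷ R) Ms → Bounded (r ∷ R) Ms
  bounded ext = bounded-acc (<-wellFounded _) (_ , here refl) ext

-- Sublists of a repetition-free list as subsets

module _ {A : Set} where

  ∈-sublists⇒⊆ : ∀ {xs ys : List A} → ys ∈ sublists xs → ∀ {x} → x ∈ ys → x ∈ xs
  ∈-sublists⇒⊆ {[]} (here refl) ()
  ∈-sublists⇒⊆ {x ∷ xs} ys∈ y∈ with ∈-++⁻ (sublists xs) ys∈
  ... | inj₁ p = there (∈-sublists⇒⊆ p y∈)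
  ... | inj₂ p with ∈-map⁻ (x ∷_) p
  ∈-sublists⇒⊆ {x ∷ xs} ys∈ (here refl) | inj₂ p | _ , _ , refl = here refl
  ∈-sublists⇒⊆ {x ∷ xs} ys∈ (there y∈)  | inj₂ p | _ , q , refl = there (∈-sublists⇒⊆ q y∈)

  sublists-unique : ∀ {xs : List A} → Unique xs → Unique (sublists xs)
  sublists-unique {[]} _ = [] ∷ []
  sublists-unique {x ∷ xs} uniq@(_ ∷ uniq′) =
    ++⁺ (sublists-unique uniq′) (map⁺ ∷-injectiveʳ (sublists-unique uniq′)) disjoint
    where
    disjoint : ∀ {ys} → ¬ (ys ∈ sublists xs × ys ∈ map (x ∷_) (sublists xs))
    disjoint (p , q) with ∈-map⁻ (x ∷_) q
    ... | _ , _ , refl = Unique[x∷xs]⇒x∉xs uniq (∈-sublists⇒⊆ p (here refl))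

  -- Sublists inherit the order of `xs`, so their members determine them. This is what turns
  -- matchings with equal mates into equal lists.
  sublists-extensional : ∀ {xs ys zs : List A} → Unique xs → ys ∈ sublists xs → zs ∈ sublists xs →
    (∀ {x} → x ∈ ys → x ∈ zs) → (∀ {x} → x ∈ zs → x ∈ ys) → ys ≡ zs
  sublists-extensional {[]} _ (here refl) (here refl) _ _ = refl
  sublists-extensional {x ∷ xs} uniq@(_ ∷ uniq′) ys∈ zs∈ ys⊆ zs⊆
    with ∈-++⁻ (sublists xs) ys∈ | ∈-++⁻ (sublists xs) zs∈
  ... | inj₁ p | inj₁ q = sublists-extensional uniq′ p q ys⊆ zs⊆
  ... | inj₁ p | inj₂ q with ∈-map⁻ (x ∷_) q
  ...   | _ , _ , refl = ⊥-elim (Unique[x∷xs]⇒x∉xs uniq (∈-sublists⇒⊆ p (zs⊆ (here refl))))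
  sublists-extensional {x ∷ xs} uniq _ _ ys⊆ zs⊆ | inj₂ p | inj₁ q with ∈-map⁻ (x ∷_) p
  ...   | _ , _ , refl = ⊥-elim (Unique[x∷xs]⇒x∉xs uniq (∈-sublists⇒⊆ q (ys⊆ (here refl))))
  sublists-extensional {x ∷ xs} uniq@(_ ∷ uniq′) _ _ ys⊆ zs⊆ | inj₂ p | inj₂ q
    with ∈-map⁻ (x ∷_) p | ∈-map⁻ (x ∷_) q
  ...   | ys′ , p′ , refl | zs′ , q′ , refl =
    cong (x ∷_) (sublists-extensional uniq′ p′ q′ (tail p′ ys⊆) (tail q′ zs⊆))
    where
    tail : ∀ {us vs} → us ∈ sublists xs → (∀ {y} → y ∈ x ∷ us → y ∈ x ∷ vs) → ∀ {y} → y ∈ us → y ∈ vs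
    tail us∈ us⊆ y∈ with us⊆ (there y∈)
    ... | here refl = ⊥-elim (Unique[x∷xs]⇒x∉xs uniq (∈-sublists⇒⊆ us∈ y∈))
    ... | there y∈′ = y∈′

-- Perfect matchings as involutions

module Mates {n : ℕ} (G : SimpleGraph n) where
  open SimpleGraph G
  open Residual G

  otherEnd : Fin n → Fin n × Fin n → Fin n
  otherEnd w (u , v) with w ≟ u
  ... | yes _ = v
  ... | no _  = u

  -- The junk value w is returned if no edge of M covers w.
  mate : List (Fin n × Fin n) → Fin n → Fin n
  mate M w with filter (endOf? G w) M
  ... | []    = w
  ... | e ∷ _ = otherEnd w e

  perfectMatchings : List (List (Fin n × Fin n))
  perfectMatchings = filter (isPerfectMatching? G) (sublists (edges G))

  otherEnd₁ : ∀ u v → otherEnd u (u , v) ≡ v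
  otherEnd₁ u v with u ≟ u
  ... | yes _  = refl
  ... | no u≢u = ⊥-elim (u≢u refl)

  otherEnd₂ : ∀ {u v} → u ≢ v → otherEnd v (u , v) ≡ u
  otherEnd₂ {u} {v} u≢v with v ≟ u
  ... | yes v≡u = ⊥-elim (u≢v (sym v≡u))
  ... | no _    = refl

  module _ {M} (M∈ : M ∈ perfectMatchings) where

    ∈-sublists : M ∈ sublists (edges G)
    ∈-sublists = proj₁ (∈-filter⁻ (isPerfectMatching? G) {xs = sublists (edges G)} M∈)

    isPerfect : IsPerfectMatching G M
    isPerfect = proj₂ (∈-filter⁻ (isPerfectMatching? G) {xs = sublists (edges G)} M∈)

    edge : ∀ {u v} → (u , v) ∈ M → (u Fin.< v) × u ~ v
    edge = ∈-edges⁻ ∘ ∈-sublists⇒⊆ ∈-sublists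

    -- Perfection makes the filtered list inspected by `mate` a singleton, which must then consist
    -- of `e`.
    mate-of : ∀ {e w} → e ∈ M → EndOf G w e → mate M w ≡ otherEnd w e
    mate-of {e} {w} e∈ end with filter (endOf? G w) M | isPerfect w | ∈-filter⁺ (endOf? G w) e∈ end
    ... | _ ∷ [] | _ | here refl = refl

    mate-ends : ∀ {u v} → (u , v) ∈ M → mate M u ≡ v × mate M v ≡ u
    mate-ends {u} {v} e∈ = trans (mate-of e∈ (inj₁ refl)) (otherEnd₁ u v)
                         , trans (mate-of e∈ (inj₂ refl)) (otherEnd₂ {u} {v} (λ { refl → ~-irr (proj₂ (edge e∈)) }))

    covered : ∀ w → ∃ λ e → e ∈ M × EndOf G w e
    covered w with filter (endOf? G w) M | isPerfect w | (λ {e} → ∈-filter⁻ (endOf? G w) {v = e} {xs = M})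
    ... | e ∷ [] | _ | sound = e , sound (here refl)

    mate-edge : ∀ w → (w , mate M w) ∈ M ⊎ (mate M w , w) ∈ M
    mate-edge w with covered w
    ... | (u , v) , e∈ , inj₁ refl = inj₁ (subst (λ x → (w , x) ∈ M) (sym (proj₁ (mate-ends e∈))) e∈)
    ... | (u , v) , e∈ , inj₂ refl = inj₂ (subst (λ x → (x , w) ∈ M) (sym (proj₂ (mate-ends e∈))) e∈)

    mate-adjacent : ∀ w → w ~ mate M w
    mate-adjacent w with mate-edge w
    ... | inj₁ e∈ = proj₂ (edge e∈)
    ... | inj₂ e∈ = ~-sym (proj₂ (edge e∈))

    mate-involutive : ∀ w → mate M (mate M w) ≡ w
    mate-involutive w with mate-edge w
    ... | inj₁ e∈ = proj₂ (mate-ends e∈)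
    ... | inj₂ e∈ = proj₁ (mate-ends e∈)

  mates-⊆ : ∀ {M M′} → M ∈ perfectMatchings → M′ ∈ perfectMatchings → (∀ v → mate M v ≡ mate M′ v) →
    ∀ {e} → e ∈ M → e ∈ M′
  mates-⊆ {M} {M′} M∈ M′∈ same {u , v} e∈ with mate-edge M′∈ u | trans (sym (same u)) (proj₁ (mate-ends M∈ e∈))
  ... | inj₁ e∈′ | eq = subst (λ x → (u , x) ∈ M′) eq e∈′
  -- Edges are listed with the smaller end first, so `M′` cannot contain the reversed pair.
  ... | inj₂ e∈′ | eq = ⊥-elim (Finₚ.<-asym (proj₁ (edge M∈ e∈))
                          (proj₁ (edge M′∈ (subst (λ x → (x , u) ∈ M′) eq e∈′))))

  module _ (cubic : Cubic G) (connected : Connected G) where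
    open Branching G cubic connected mate

    all-extensions : Extensions [] perfectMatchings
    all-extensions = record
      { unique      = filter⁺ (isPerfectMatching? G) (sublists-unique edges-unique)
      ; matched     = mate-adjacent
      ; involutive  = mate-involutive
      ; extensional = λ M∈ M′∈ same → sublists-extensional edges-unique (∈-sublists M∈) (∈-sublists M′∈)
          (mates-⊆ M∈ M′∈ same) (mates-⊆ M′∈ M∈ (sym ∘ same))
      ; agree       = λ _ _ ()
      ; closed      = λ _ ()
      }

-- Matchings around a pentagon

module Neighbourhood {V : Set} {_~_ : V → V → Set} {Turn : V → V → V → Set}
  (walks : FaceWalks.CubicFaceWalks _~_ Turn) where
  open FaceWalks _~_ Turn
  open CubicFaceWalks walks

  module _ {a b c d e a′ b′ c′ d′ e′} (P : Pentagon walks a b c d e a′ b′ c′ d′ e′) where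

    private
      Pᵇ = rotatePentagon walks P
      Pᶜ = rotatePentagon walks Pᵇ
      Pᵈ = rotatePentagon walks Pᶜ
      Pᵉ = rotatePentagon walks Pᵈ

    a-apart : VecAll (a ≢_) (b ∷ c ∷ d ∷ e ∷ a′ ∷ b′ ∷ c′ ∷ d′ ∷ e′ ∷ [])
    a-apart = a≢b walks P ∷ a≢c walks P ∷ ≢-sym (a≢c walks Pᵈ) ∷ ≢-sym (a≢b walks Pᵉ)
      ∷ ≢-sym (third≢a walks P) ∷ ≢-sym (third≢e walks Pᵇ) ∷ ≢-sym (third≢d walks Pᶜ)
      ∷ ≢-sym (third≢c walks Pᵈ) ∷ ≢-sym (third≢b walks Pᵉ) ∷ []

    a′-apart : VecAll (a′ ≢_) (b′ ∷ c′ ∷ d′ ∷ e′ ∷ [])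
    a′-apart = thirds-distinct₁ walks P ∷ thirds-distinct₂ walks P
      ∷ ≢-sym (thirds-distinct₂ walks Pᵈ) ∷ ≢-sym (thirds-distinct₁ walks Pᵉ) ∷ []

    -- The three neighbours of each pentagon vertex other than a are known, and a′ is none of them;
    -- the other third neighbours are not adjacent to a′.
    a′-outward : ∀ {w} → w ~ a′ → w ≢ a →
      VecAll (w ≢_) (a ∷ b ∷ c ∷ d ∷ e ∷ a′ ∷ b′ ∷ c′ ∷ d′ ∷ e′ ∷ [])
    a′-outward {w} w~a′ w≢a = w≢a
      ∷ off Pᵇ (third≢c walks P) (third≢a walks P) (thirds-distinct₁ walks P)
      ∷ off Pᶜ (third≢d walks P) (third≢b walks P) (thirds-distinct₂ walks P)
      ∷ off Pᵈ (third≢e walks P) (third≢c walks P) (≢-sym (thirds-distinct₂ walks Pᵈ))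
      ∷ off Pᵉ (third≢a walks P) (third≢d walks P) (≢-sym (thirds-distinct₁ walks Pᵉ))
      ∷ (λ { refl → ~-irr w~a′ })
      ∷ (λ { refl → thirds-nonadjacent₁ walks P (~-sym w~a′) })
      ∷ (λ { refl → thirds-nonadjacent₂ walks P (~-sym w~a′) })
      ∷ (λ { refl → thirds-nonadjacent₂ walks Pᵈ w~a′ })
      ∷ (λ { refl → thirds-nonadjacent₁ walks Pᵉ w~a′ }) ∷ []
      where
      off : ∀ {p q r s t p′ q′ r′ s′ t′} → Pentagon walks p q r s t p′ q′ r′ s′ t′ →
        a′ ≢ q → a′ ≢ t → a′ ≢ p′ → w ≢ p
      off Q ≢q ≢t ≢p′ refl with aroundVertex walks Q (~-sym w~a′)
      ... | inj₁ eq        = ≢q eq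
      ... | inj₂ (inj₁ eq) = ≢t eq
      ... | inj₂ (inj₂ eq) = ≢p′ eq

    a′-others : ∃ λ p → ∃ λ q → p ≢ q × (a′ ~ p × p ≢ a) × (a′ ~ q × q ≢ a)
    a′-others with turn-next (a~a′ walks P)
    ... | p , aa′p with turn-next (~-sym (turn-target aa′p))
    ... | q , pa′q = p , q , turn-≢ pa′q , (turn-target aa′p , ≢-sym (turn-≢ aa′p))
                   , (turn-target pa′q , turn-≢ (cyclic aa′p pa′q))

  rotateAll : ∀ {P : V → Set} {a b c d e a′ b′ c′ d′ e′} →
    VecAll P (b ∷ c ∷ d ∷ e ∷ a ∷ b′ ∷ c′ ∷ d′ ∷ e′ ∷ a′ ∷ []) →
    VecAll P (a ∷ b ∷ c ∷ d ∷ e ∷ a′ ∷ b′ ∷ c′ ∷ d′ ∷ e′ ∷ [])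
  rotateAll (b ∷ c ∷ d ∷ e ∷ a ∷ b′ ∷ c′ ∷ d′ ∷ e′ ∷ a′ ∷ []) =
    a ∷ b ∷ c ∷ d ∷ e ∷ a′ ∷ b′ ∷ c′ ∷ d′ ∷ e′ ∷ []

  module _ {a b c d e a′ b′ c′ d′ e′} (P : Pentagon walks a b c d e a′ b′ c′ d′ e′) where

    private
      Pᵇ = rotatePentagon walks P
      Pᶜ = rotatePentagon walks Pᵇ
      Pᵈ = rotatePentagon walks Pᶜ
      Pᵉ = rotatePentagon walks Pᵈ

    ten : Vec V 10
    ten = a ∷ b ∷ c ∷ d ∷ e ∷ a′ ∷ b′ ∷ c′ ∷ d′ ∷ e′ ∷ []

    ten-unique : VecUnique ten
    ten-unique with a-apart P | a-apart Pᵇ | a-apart Pᶜ | a-apart Pᵈ | a-apart Pᵉ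
    ... | row-a
        | bc ∷ bd ∷ be ∷ ba ∷ bb′ ∷ bc′ ∷ bd′ ∷ be′ ∷ ba′ ∷ []
        | cd ∷ ce ∷ ca ∷ cb ∷ cc′ ∷ cd′ ∷ ce′ ∷ ca′ ∷ cb′ ∷ []
        | de ∷ da ∷ db ∷ dc ∷ dd′ ∷ de′ ∷ da′ ∷ db′ ∷ dc′ ∷ []
        | ea ∷ eb ∷ ec ∷ ed ∷ ee′ ∷ ea′ ∷ eb′ ∷ ec′ ∷ ed′ ∷ []
      with a′-apart P | a′-apart Pᵇ | a′-apart Pᶜ | a′-apart Pᵈ
    ...   | row-a′ | b′c′ ∷ b′d′ ∷ b′e′ ∷ _ | c′d′ ∷ c′e′ ∷ _ | d′e′ ∷ _ =
      row-a
      ∷ (bc ∷ bd ∷ be ∷ ba′ ∷ bb′ ∷ bc′ ∷ bd′ ∷ be′ ∷ [])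
      ∷ (cd ∷ ce ∷ ca′ ∷ cb′ ∷ cc′ ∷ cd′ ∷ ce′ ∷ [])
      ∷ (de ∷ da′ ∷ db′ ∷ dc′ ∷ dd′ ∷ de′ ∷ [])
      ∷ (ea′ ∷ eb′ ∷ ec′ ∷ ed′ ∷ ee′ ∷ [])
      ∷ row-a′
      ∷ (b′c′ ∷ b′d′ ∷ b′e′ ∷ [])
      ∷ (c′d′ ∷ c′e′ ∷ [])
      ∷ (d′e′ ∷ [])
      ∷ [] ∷ []

    -- Indices 0 to 4 stand for a to e, and 5 to 9 for their third neighbours in the same order.
    -- With numerals as indices, the `False` arguments are filled in by evaluation.
    apart : ∀ i j {i≢j : False (i ≟ j)} → lookup ten i ≢ lookup ten j
    apart i j {i≢j} eq = toWitnessFalse i≢j (lookup-injective ten-unique i j eq)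

    at : Fin 10 → V
    at = lookup ten

    at∉ : ∀ i is {i∉is : False (member? _≟_ i is)} → at i ∉ map at is
    at∉ i is {i∉is} p with ∈-map⁻ at p
    ... | j , j∈ , eq = toWitnessFalse i∉is (subst (_∈ is) (sym (lookup-injective ten-unique i j eq)) j∈)

    -- The two neighbours p and q avoid the whole configuration, so they are still present whichever
    -- of the ten vertices have been deleted, and deleting `x′` costs at least four arcs.
    Outer : V → Set
    Outer x′ = ∃ λ p → ∃ λ q → p ≢ q × (x′ ~ p × VecAll (p ≢_) ten) × (x′ ~ q × VecAll (q ≢_) ten)

    outer-a : Outer a′
    outer-a with a′-others P
    ... | p , q , p≢q , (a′~p , p≢a) , (a′~q , q≢a) =
      p , q , p≢q , (a′~p , a′-outward P (~-sym a′~p) p≢a) , (a′~q , a′-outward P (~-sym a′~q) q≢a)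

  rotateOuter : ∀ {a b c d e a′ b′ c′ d′ e′} (P : Pentagon walks a b c d e a′ b′ c′ d′ e′) {x′ : V} →
    Outer (rotatePentagon walks P) x′ → Outer P x′
  rotateOuter P (p , q , p≢q , (e , ps) , (f , qs)) = p , q , p≢q , (e , rotateAll ps) , (f , rotateAll qs)

module AroundPentagon {n : ℕ} (G : SimpleGraph n) (cubic : Cubic G) (connected : Connected G)
  {X : Set} (mate : X → Fin n → Fin n)
  {Turn : Fin n → Fin n → Fin n → Set} (walks : FaceWalks.CubicFaceWalks (SimpleGraph._~_ G) Turn) where
  open SimpleGraph G
  open Residual G
  open Deletion G
  open Branching G cubic connected mate
  open FaceWalks _~_ Turn hiding (module CubicFaceWalks)
  open Neighbourhood walks

  module _ {a b c d e a′ b′ c′ d′ e′} (P : Pentagon walks a b c d e a′ b′ c′ d′ e′) where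
    private
      Pᵇ = rotatePentagon walks P
      Pᶜ = rotatePentagon walks Pᵇ
      Pᵈ = rotatePentagon walks Pᶜ
      Pᵉ = rotatePentagon walks Pᵈ

    outer-b : Outer P b′
    outer-b = rotateOuter P (outer-a Pᵇ)

    outer-c : Outer P c′
    outer-c = rotateOuter P (rotateOuter Pᵇ (outer-a Pᶜ))

    outer-d : Outer P d′
    outer-d = rotateOuter P (rotateOuter Pᵇ (rotateOuter Pᶜ (outer-a Pᵈ)))

    outer-e : Outer P e′
    outer-e = rotateOuter P (rotateOuter Pᵇ (rotateOuter Pᶜ (rotateOuter Pᵈ (outer-a Pᵉ))))

    outside : ∀ {w} → VecAll (w ≢_) (ten P) → ∀ is → w ∉ map (at P) is
    outside w≢ is w∈ with ∈-map⁻ (at P) w∈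
    ... | j , _ , eq = vecAll-lookup w≢ j eq

    deleteOuter : ∀ i is {i∉is : False (member? _≟_ i is)} → Outer P (at P i) →
      Drop (map (at P) (i ∷ is)) 4 (map (at P) is)
    deleteOuter i is {i∉is} (p , q , p≢q , (~p , p≢) , (~q , q≢)) =
      delete₂ (at∉ P i is {i∉is}) p≢q ~p (outside p≢ is) ~q (outside q≢ is)

    deleteInner : ∀ i is j k {i∉ : False (member? _≟_ i is)} {j∉ : False (member? _≟_ j is)}
      {k∉ : False (member? _≟_ k is)} {j≢k : False (j ≟ k)} →
      at P i ~ at P j → at P i ~ at P k → Drop (map (at P) (i ∷ is)) 4 (map (at P) is)
    deleteInner i is j k {i∉} {j∉} {k∉} {j≢k} ~j ~k =
      delete₂ (at∉ P i is {i∉}) (apart P j k {j≢k}) ~j (at∉ P j is {j∉}) ~k (at∉ P k is {k∉})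

    deleteLast : ∀ i is j {i∉ : False (member? _≟_ i is)} {j∉ : False (member? _≟_ j is)} →
      at P i ~ at P j → Drop (map (at P) (i ∷ is)) 2 (map (at P) is)
    deleteLast i is j {i∉} {j∉} ~j = delete₁ (at∉ P i is {i∉}) ~j (at∉ P j is {j∉})

    aa′ = a~a′ walks P
    bb′ = a~a′ walks Pᵇ
    cc′ = a~a′ walks Pᶜ
    dd′ = a~a′ walks Pᵈ
    ee′ = a~a′ walks Pᵉ
    ab = a~b walks P
    bc = a~b walks Pᵇ
    cd = a~b walks Pᶜ
    de = a~b walks Pᵈ
    ea = a~b walks Pᵉ

    delete-a : Drop (a ∷ []) 6 []
    delete-a = delete₃ (λ ()) (apart P (# 1) (# 4)) (apart P (# 1) (# 5)) (apart P (# 4) (# 5))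
      ab (λ ()) (~-sym ea) (λ ()) aa′ (λ ())

    -- One representative per pattern, up to rotation. With one vertex matched outward, the path of
    -- the other four has only one perfect matching. With three, the other two are matched to each
    -- other, hence adjacent, so the three are consecutive.
    oneOut threeOut fiveOut : List X → List X
    oneOut Ms   = select d e (select b c (select a a′ Ms))
    threeOut Ms = select d e (select c c′ (select b b′ (select a a′ Ms)))
    fiveOut Ms  = select e e′ (select d d′ (select c c′ (select b b′ (select a a′ Ms))))

    module _ {Ms : List X} (ext : Extensions [] Ms) where
      open Extensions ext

      -- Each edge is charged to its end deleted first: three to a, two each to a′, b, c and d, one
      -- to e. These 12 edges are 24 arcs, and `2 ^ 24` is `8 ^ 8`. The next two bounds count in the
      -- same way.
      oneOut-bound : length (oneOut Ms) ^ 8 * 2 ^ 24 ≤ 2 ^ #arcs []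
      oneOut-bound = shrink (length (oneOut Ms)) 24
        (bounded (select-extensions d e (select-extensions b c (select-extensions a a′ ext))))
        (fewer-arcs
          ( deleteLast  (# 4) (# 3 ∷ # 2 ∷ # 1 ∷ # 5 ∷ # 0 ∷ []) (# 9) ee′
          ⨾ deleteInner (# 3) (# 2 ∷ # 1 ∷ # 5 ∷ # 0 ∷ []) (# 4) (# 8) de dd′
          ⨾ deleteInner (# 2) (# 1 ∷ # 5 ∷ # 0 ∷ []) (# 3) (# 7) cd cc′
          ⨾ deleteInner (# 1) (# 5 ∷ # 0 ∷ []) (# 2) (# 6) bc bb′
          ⨾ deleteOuter (# 5) (# 0 ∷ []) (outer-a P)
          ⨾ delete-a))

      threeOut-bound : length (threeOut Ms) ^ 8 * 2 ^ 32 ≤ 2 ^ #arcs []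
      threeOut-bound = shrink (length (threeOut Ms)) 32
        (bounded (select-extensions d e (select-extensions c c′ (select-extensions b b′ (select-extensions a a′ ext)))))
        (fewer-arcs
          ( deleteLast  (# 4) (# 3 ∷ # 7 ∷ # 2 ∷ # 6 ∷ # 1 ∷ # 5 ∷ # 0 ∷ []) (# 9) ee′
          ⨾ deleteInner (# 3) (# 7 ∷ # 2 ∷ # 6 ∷ # 1 ∷ # 5 ∷ # 0 ∷ []) (# 4) (# 8) de dd′
          ⨾ deleteOuter (# 7) (# 2 ∷ # 6 ∷ # 1 ∷ # 5 ∷ # 0 ∷ []) outer-c
          ⨾ deleteInner (# 2) (# 6 ∷ # 1 ∷ # 5 ∷ # 0 ∷ []) (# 3) (# 7) cd cc′
          ⨾ deleteOuter (# 6) (# 1 ∷ # 5 ∷ # 0 ∷ []) outer-b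
          ⨾ deleteInner (# 1) (# 5 ∷ # 0 ∷ []) (# 2) (# 6) bc bb′
          ⨾ deleteOuter (# 5) (# 0 ∷ []) (outer-a P)
          ⨾ delete-a))

      fiveOut-bound : length (fiveOut Ms) ^ 8 * 2 ^ 40 ≤ 2 ^ #arcs []
      fiveOut-bound = shrink (length (fiveOut Ms)) 40
        (bounded (select-extensions e e′ (select-extensions d d′ (select-extensions c c′
          (select-extensions b b′ (select-extensions a a′ ext))))))
        (fewer-arcs
          ( deleteOuter (# 9) (# 4 ∷ # 8 ∷ # 3 ∷ # 7 ∷ # 2 ∷ # 6 ∷ # 1 ∷ # 5 ∷ # 0 ∷ []) outer-e
          ⨾ deleteLast  (# 4) (# 8 ∷ # 3 ∷ # 7 ∷ # 2 ∷ # 6 ∷ # 1 ∷ # 5 ∷ # 0 ∷ []) (# 9) ee′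
          ⨾ deleteOuter (# 8) (# 3 ∷ # 7 ∷ # 2 ∷ # 6 ∷ # 1 ∷ # 5 ∷ # 0 ∷ []) outer-d
          ⨾ deleteInner (# 3) (# 7 ∷ # 2 ∷ # 6 ∷ # 1 ∷ # 5 ∷ # 0 ∷ []) (# 4) (# 8) de dd′
          ⨾ deleteOuter (# 7) (# 2 ∷ # 6 ∷ # 1 ∷ # 5 ∷ # 0 ∷ []) outer-c
          ⨾ deleteInner (# 2) (# 6 ∷ # 1 ∷ # 5 ∷ # 0 ∷ []) (# 3) (# 7) cd cc′
          ⨾ deleteOuter (# 6) (# 1 ∷ # 5 ∷ # 0 ∷ []) outer-b
          ⨾ deleteInner (# 1) (# 5 ∷ # 0 ∷ []) (# 2) (# 6) bc bb′
          ⨾ deleteOuter (# 5) (# 0 ∷ []) (outer-a P)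
          ⨾ delete-a))

      onward : ∀ {M} → M ∈ Ms → mate M a ≢ b → mate M b ≡ c ⊎ mate M b ≡ b′
      onward {M} M∈ a↛b with aroundVertex walks Pᵇ (~-sym (matched M∈ b))
      ... | inj₁ bc        = inj₁ bc
      ... | inj₂ (inj₁ ba) = ⊥-elim (a↛b (mate-sym M∈ ba))
      ... | inj₂ (inj₂ bb) = inj₂ bb

  module _ {a b c d e a′ b′ c′ d′ e′} (P : Pentagon walks a b c d e a′ b′ c′ d′ e′)
           {Ms : List X} (ext : Extensions [] Ms) where
    open Extensions ext
    private
      Pᵇ = rotatePentagon walks P
      Pᶜ = rotatePentagon walks Pᵇ
      Pᵈ = rotatePentagon walks Pᶜ
      Pᵉ = rotatePentagon walks Pᵈ

    ones threes : List (List X)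
    ones   = oneOut P Ms ∷ oneOut Pᵇ Ms ∷ oneOut Pᶜ Ms ∷ oneOut Pᵈ Ms ∷ oneOut Pᵉ Ms ∷ []
    threes = threeOut P Ms ∷ threeOut Pᵇ Ms ∷ threeOut Pᶜ Ms ∷ threeOut Pᵈ Ms ∷ threeOut Pᵉ Ms ∷ []

    Classified : X → Set
    Classified M = Any (M ∈_) ones ⊎ Any (M ∈_) threes ⊎ M ∈ fiveOut P Ms

    module _ {M} (M∈ : M ∈ Ms) where

      two-matches : ∀ {u v w x} → mate M u ≡ v → mate M w ≡ x → M ∈ select w x (select u v Ms)
      two-matches p q = ∈-select⁺ (∈-select⁺ M∈ p) q

      three-matches : ∀ {u v w x y z} → mate M u ≡ v → mate M w ≡ x → mate M y ≡ z →
        M ∈ select y z (select w x (select u v Ms))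
      three-matches p q r = ∈-select⁺ (two-matches p q) r

      four-matches : ∀ {u v w x y z s t} → mate M u ≡ v → mate M w ≡ x → mate M y ≡ z → mate M s ≡ t →
        M ∈ select s t (select y z (select w x (select u v Ms)))
      four-matches p q r s = ∈-select⁺ (three-matches p q r) s

      avoid : ∀ {u v} i → {i≢ : False (i ≟ v)} → mate M u ≡ at P i → mate M u ≢ at P v
      avoid {v = v} i {i≢} p q = apart P i v {i≢} (trans (sym p) q)

      e-outward : mate M d ≢ e → mate M a ≢ e → mate M e ≡ e′
      e-outward d↛e a↛e with onward Pᵈ ext M∈ d↛e
      ... | inj₁ ea = ⊥-elim (a↛e (mate-sym M∈ ea))
      ... | inj₂ ee = ee

      e-inward : mate M a ≡ e → mate M d ≢ e
      e-inward ae de = apart P (# 0) (# 3) (trans (sym (mate-sym M∈ ae)) (mate-sym M∈ de))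

      -- Starting from the partner of a, `onward` settles the vertices in cyclic order. The position
      -- in `ones` or `threes` is the rotation beginning at the only outward vertex, or at the first
      -- of three consecutive ones. Parity excludes the other patterns: they would give e the two
      -- partners a and d, which `e-inward` refutes.
      classify : Classified M
      classify with aroundVertex walks P (~-sym (matched M∈ a))
      classify | inj₂ (inj₂ aa) with onward P ext M∈ (avoid {v = # 1} (# 5) aa)
      classify | inj₂ (inj₂ aa) | inj₁ bc
        with onward Pᶜ ext M∈ (λ cd → apart P (# 1) (# 3) (trans (sym (mate-sym M∈ bc)) cd))
      ... | inj₁ de = inj₁ (here (three-matches aa bc de))
      ... | inj₂ dd = inj₂ (inj₁ (there (there (there (here (four-matches dd ee aa bc))))))
        where ee = e-outward (avoid {v = # 4} (# 8) dd) (avoid {v = # 4} (# 5) aa)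
      classify | inj₂ (inj₂ aa) | inj₂ bb with onward Pᵇ ext M∈ (avoid {v = # 2} (# 6) bb)
      ... | inj₁ cd = inj₂ (inj₁ (there (there (there (there (here (four-matches ee aa bb cd)))))))
        where ee = e-outward (λ de → apart P (# 2) (# 4) (trans (sym (mate-sym M∈ cd)) de)) (avoid {v = # 4} (# 5) aa)
      ... | inj₂ cc with onward Pᶜ ext M∈ (avoid {v = # 3} (# 7) cc)
      ...   | inj₁ de = inj₂ (inj₁ (here (four-matches aa bb cc de)))
      ...   | inj₂ dd = inj₂ (inj₂ (∈-select⁺ (four-matches aa bb cc dd)
                (e-outward (avoid {v = # 4} (# 8) dd) (avoid {v = # 4} (# 5) aa))))
      classify | inj₁ ab with onward Pᵇ ext M∈ (λ bc → apart P (# 0) (# 2) (trans (sym (mate-sym M∈ ab)) bc))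
      ... | inj₁ cd = inj₁ (there (there (there (there (here (three-matches ee ab cd))))))
        where ee = e-outward (λ de → apart P (# 2) (# 4) (trans (sym (mate-sym M∈ cd)) de)) (avoid {v = # 4} (# 1) ab)
      ... | inj₂ cc with onward Pᶜ ext M∈ (avoid {v = # 3} (# 7) cc)
      ...   | inj₁ de = inj₁ (there (there (here (three-matches cc de ab))))
      ...   | inj₂ dd = inj₂ (inj₁ (there (there (here (four-matches cc dd ee ab)))))
        where ee = e-outward (avoid {v = # 4} (# 8) dd) (avoid {v = # 4} (# 1) ab)
      classify | inj₂ (inj₁ ae) with onward P ext M∈ (avoid {v = # 1} (# 4) ae)
      ... | inj₁ bc with onward Pᶜ ext M∈ (λ cd → apart P (# 1) (# 3) (trans (sym (mate-sym M∈ bc)) cd))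
      ...   | inj₁ de = ⊥-elim (e-inward ae de)
      ...   | inj₂ dd = inj₁ (there (there (there (here (three-matches dd (mate-sym M∈ ae) bc)))))
      classify | inj₂ (inj₁ ae) | inj₂ bb with onward Pᵇ ext M∈ (avoid {v = # 2} (# 6) bb)
      ... | inj₁ cd = inj₁ (there (here (three-matches bb cd (mate-sym M∈ ae))))
      ... | inj₂ cc with onward Pᶜ ext M∈ (avoid {v = # 3} (# 7) cc)
      ...   | inj₁ de = ⊥-elim (e-inward ae de)
      ...   | inj₂ dd = inj₂ (inj₁ (there (here (four-matches bb cc dd (mate-sym M∈ ae)))))

    length-concat-bound : ∀ {k r} {Ls : List (List X)} → All (λ L → length L * k ≤ r) Ls →
      length (concat Ls) * k ≤ length Ls * r
    length-concat-bound [] = z≤n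
    length-concat-bound {k} {r} {L ∷ Ls} (p ∷ ps) = begin
      length (L ++ concat Ls) * k              ≡⟨ cong (_* k) (length-++ L {concat Ls}) ⟩
      (length L + length (concat Ls)) * k      ≡⟨ ℕₚ.*-distribʳ-+ k (length L) (length (concat Ls)) ⟩
      length L * k + length (concat Ls) * k    ≤⟨ ℕₚ.+-mono-≤ p (length-concat-bound ps) ⟩
      r + length Ls * r                        ∎
      where open ℕₚ.≤-Reasoning

    all-classified : length Ms ≤ length (concat ones) + (length (concat threes) + length (fiveOut P Ms))
    all-classified = ℕₚ.≤-trans
      (unique⊆∪⇒length≤ {As = concat ones} {concat threes ++ fiveOut P Ms} unique λ M∈ → case classify M∈ of λ
        { (inj₁ p)        → inj₁ (∈-concat⁺ p)
        ; (inj₂ (inj₁ p)) → inj₂ (∈-++⁺ˡ (∈-concat⁺ p))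
        ; (inj₂ (inj₂ p)) → inj₂ (∈-++⁺ʳ (concat threes) p) })
      (ℕₚ.≤-reflexive (cong (length (concat ones) +_) (length-++ (concat threes))))

    -- Each of the three kinds contributes at most 5/8, 5/16 and 1/32 of the bound.
    pentagon-bound : length Ms ^ 8 ≤ 2 ^ #arcs []
    pentagon-bound with eighth-root (2 ^ #arcs [])
    ... | r , r⁸≤ , greatest = ℕₚ.≤-trans (ℕₚ.^-monoˡ-≤ 8 (ℕₚ.*-cancelʳ-≤ (length Ms) r 32 (begin
        length Ms * 32                           ≤⟨ ℕₚ.*-monoˡ-≤ 32 all-classified ⟩
        (#1 + (#3 + #5)) * 32                    ≡⟨ regroup #1 #3 #5 ⟩
        #1 * 8 * 4 + #3 * 16 * 2 + #5 * 32       ≤⟨ ℕₚ.+-mono-≤ (ℕₚ.+-mono-≤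
          (ℕₚ.*-monoˡ-≤ 4 (length-concat-bound {8} {Ls = ones}
            (one-bound P ∷ one-bound Pᵇ ∷ one-bound Pᶜ ∷ one-bound Pᵈ ∷ one-bound Pᵉ ∷ [])))
          (ℕₚ.*-monoˡ-≤ 2 (length-concat-bound {16} {Ls = threes}
            (three-bound P ∷ three-bound Pᵇ ∷ three-bound Pᶜ ∷ three-bound Pᵈ ∷ three-bound Pᵉ ∷ []))))
          (scaled #5 32 greatest (fiveOut-bound P ext)) ⟩
        5 * r * 4 + 5 * r * 2 + r                ≤⟨ ℕₚ.m≤m+n _ r ⟩
        5 * r * 4 + 5 * r * 2 + r + r            ≡⟨ total r ⟩
        r * 32                                   ∎))) r⁸≤
      where
      open ℕₚ.≤-Reasoning
      #1 = length (concat ones)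
      #3 = length (concat threes)
      #5 = length (fiveOut P Ms)

      one-bound : ∀ {a b c d e a′ b′ c′ d′ e′} (Q : Pentagon walks a b c d e a′ b′ c′ d′ e′) →
        length (oneOut Q Ms) * 8 ≤ r
      one-bound Q = scaled (length (oneOut Q Ms)) 8 greatest (oneOut-bound Q ext)

      three-bound : ∀ {a b c d e a′ b′ c′ d′ e′} (Q : Pentagon walks a b c d e a′ b′ c′ d′ e′) →
        length (threeOut Q Ms) * 16 ≤ r
      three-bound Q = scaled (length (threeOut Q Ms)) 16 greatest (threeOut-bound Q ext)

      regroup : ∀ x y z → (x + (y + z)) * 32 ≡ x * 8 * 4 + y * 16 * 2 + z * 32
      regroup = solve-∀

      total : ∀ r → 5 * r * 4 + 5 * r * 2 + r + r ≡ r * 32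
      total = solve-∀

-- The common bound for fullerene graphs

module _ {n : ℕ} (G : SimpleGraph n) (F : Fullerene G) where
  open Fullerene F
  open Residual G
  open Mates G

  perfmat-bound : perfmat G ^ 8 ≤ 8 ^ n
  perfmat-bound with pentagonalFace G F
  ... | f , B with faceBoundary G F B (Cycle.adjacent (proj₁ B) zero) (Equivalence.from (proj₂ B _) (zero , refl))
  -- On `Fin 5` the successors evaluate, so the five turns chain together and the last two wrap
  -- around.
  ...   | _ , _ , turns with withThirdNeighbours (cubicFaceWalks G F)
          (turns (# 0)) (turns (# 1)) (turns (# 2)) (turns (# 3)) (turns (# 4))
          where open FaceWalks (SimpleGraph._~_ G) (Turn G F)
  ...     | _ , _ , _ , _ , _ , P = begin
    perfmat G ^ 8    ≤⟨ pentagon-bound P (all-extensions cubic connected) ⟩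
    2 ^ #arcs []     ≡⟨ cong (2 ^_) (trans (#arcs-cubic cubic) (ℕₚ.*-comm n 3)) ⟩
    2 ^ (3 * n)      ≡⟨ ℕₚ.^-*-assoc 2 3 n ⟨
    8 ^ n            ∎
    where
    open ℕₚ.≤-Reasoning
    open AroundPentagon G cubic connected mate (cubicFaceWalks G F)

-- Numerical comparison with the three stated bounds

square-cancel-≤ : ∀ {x y} → x * x ≤ y * y → x ≤ y
square-cancel-≤ xx≤yy = ℕₚ.≮⇒≥ λ y<x → ℕₚ.<⇒≱ (ℕₚ.*-mono-< y<x y<x) xx≤yy

-- Two factors 8 are traded for 3 ^ 4, as 64 ≤ 81. Truncation is harmless, since `n ∸ 2 + 2` is
-- never below `n`.
8^≤8^*3^4 : ∀ n → 8 ^ n ≤ 8 ^ (n ∸ 2) * 3 ^ 4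
8^≤8^*3^4 n = begin
  8 ^ n                ≤⟨ ℕₚ.^-monoʳ-≤ 8 (subst (n ≤_) (ℕₚ.+-comm 2 (n ∸ 2)) (ℕₚ.m≤n+m∸n n 2)) ⟩
  8 ^ (n ∸ 2 + 2)      ≡⟨ ℕₚ.^-distribˡ-+-* 8 (n ∸ 2) 2 ⟩
  8 ^ (n ∸ 2) * 8 ^ 2  ≤⟨ ℕₚ.*-monoʳ-≤ (8 ^ (n ∸ 2)) (ℕₚ.≤ᵇ⇒≤ (8 ^ 2) (3 ^ 4) _) ⟩
  8 ^ (n ∸ 2) * 3 ^ 4  ∎
  where open ℕₚ.≤-Reasoning

-- In the square each factor 3 becomes 9, which replaces a factor 8.
8^≤[8^*3^]² : ∀ {n} m → 2 * m ≤ n →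
  8 ^ n ≤ (8 ^ m * 3 ^ (n ∸ 2 * m)) * (8 ^ m * 3 ^ (n ∸ 2 * m))
8^≤[8^*3^]² {n} m 2m≤n = begin
  8 ^ n                              ≡⟨ cong (8 ^_) (ℕₚ.m+[n∸m]≡n 2m≤n) ⟨
  8 ^ (2 * m + k)                    ≡⟨ ℕₚ.^-distribˡ-+-* 8 (2 * m) k ⟩
  8 ^ (2 * m) * 8 ^ k                ≤⟨ ℕₚ.*-monoʳ-≤ (8 ^ (2 * m)) (ℕₚ.^-monoˡ-≤ k (ℕₚ.n≤1+n 8)) ⟩
  8 ^ (2 * m) * 9 ^ k                ≡⟨ cong₂ _*_ (double 8 m) (^-distribʳ-* 3 3 k) ⟩
  8 ^ m * 8 ^ m * (3 ^ k * 3 ^ k)    ≡⟨ ℕₚ.[m*n]*[o*p]≡[m*o]*[n*p] (8 ^ m) (8 ^ m) (3 ^ k) (3 ^ k) ⟩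
  8 ^ m * 3 ^ k * (8 ^ m * 3 ^ k)    ∎
  where
  open ℕₚ.≤-Reasoning
  k = n ∸ 2 * m
  double : ∀ b m → b ^ (2 * m) ≡ b ^ m * b ^ m
  double b m = trans (ℕₚ.^-distribˡ-+-* b m (m + 0)) (cong (λ j → b ^ m * b ^ j) (ℕₚ.+-identityʳ m))

-- The quotient is at most 5n/12, below n/2 or equal to it; hence the exponent of 3 in the third
-- bound is a genuine difference.
twice-quotient≤ : ∀ n → 2 * ((5 * n ∸ 4) / 12) ≤ n
twice-quotient≤ n = ℕₚ.*-cancelˡ-≤ 6 (begin
  6 * (2 * m)      ≡⟨ ℕₚ.*-assoc 6 2 m ⟨
  12 * m           ≡⟨ ℕₚ.*-comm 12 m ⟩
  m * 12           ≤⟨ m/n*n≤m (5 * n ∸ 4) 12 ⟩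
  5 * n ∸ 4        ≤⟨ ℕₚ.m∸n≤m (5 * n) 4 ⟩
  5 * n            ≤⟨ ℕₚ.*-monoˡ-≤ n (ℕₚ.n≤1+n 5) ⟩
  6 * n            ∎)
  where
  open ℕₚ.≤-Reasoning
  m = (5 * n ∸ 4) / 12

corollary5p3 : ∀ (n : ℕ) (G : SimpleGraph n) → Fullerene G →
    (Hamiltonian G → 4 ∣ n → perfmat G ^ 8 ≤ 8 ^ n)
    × (Hamiltonian G → ¬ (4 ∣ n) → perfmat G ^ 8 ≤ 8 ^ (n ∸ 2) * 3 ^ 4)
    × (let m = (5 * n ∸ 4) / 12 in perfmat G ^ 4 ≤ 8 ^ m * 3 ^ (n ∸ 2 * m))
corollary5p3 n G F =
    (λ _ _ → perfmat-bound G F)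
  , (λ _ _ → ℕₚ.≤-trans (perfmat-bound G F) (8^≤8^*3^4 n))
  -- The third bound concerns the fourth power, so both sides are squared to meet the eighth-power
  -- bound.
  , square-cancel-≤ (begin
      perfmat G ^ 4 * perfmat G ^ 4  ≡⟨ ℕₚ.^-distribˡ-+-* (perfmat G) 4 4 ⟨
      perfmat G ^ 8                  ≤⟨ perfmat-bound G F ⟩
      8 ^ n                          ≤⟨ 8^≤[8^*3^]² ((5 * n ∸ 4) / 12) (twice-quotient≤ n) ⟩
      _                              ∎)
  where open ℕₚ.≤-Reasoning
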